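{- Let $X\subseteq\mathbb{Z}^2\setminus\{O\}$ be an arbitrary finite step set, and let $\mathcal{C}$ be a submonoid of $\mathbb{Z}^2$. Suppose also that there is an (open) cone $K\subseteq\mathbb{R}^2$ with vertex $O$ such that $K\cap\mathbb{Z}^2\subseteq\mathcal{C}$ and $K\cap\mathcal{A}_X^{\mathcal{C}}\neq\varnothing$. Then the following are equivalent: (i) $(X,\mathcal{C})$ has the Finite Paths Property (FPP); (ii) $O\notin\operatorname{Conv}(X)$; (iii) $X$ satisfies the Line Condition (LC).
   Context: Write $O=(0,0)$. A step set is any subset $X$ of $\mathbb{Z}^2\setminus\{O\}$. $\mathcal{F}_X$ is the free monoid on $X$ (all finite words over $X$, including the empty word), with $\ell(w)$ the length of $w$; for $w=A_1\cdots A_k\in\mathcal{F}_X$ put $\alpha_X(w)=A_1+\cdots+A_k$ and, for $0\le m\le k$, $\sigma_m(w)=A_1\cdots A_m$. For a submonoid $\mathcal{C}$ of $\mathbb{Z}^2$, define $\mathcal{F}_X^{\mathcal{C}}=\{w\in\mathcal{F}_X:\alpha_X(\sigma_m(w))\in\mathcal{C}\text{ for all }0\le m\le\ell(w)\}$ and $\mathcal{A}_X^{\mathcal{C}}=\alpha_X(\mathcal{F}_X^{\mathcal{C}})$. For $A\in\mathbb{Z}^2$, $\pi_X^{\mathcal{C}}(A)$ is the (possibly infinite) number of $w\in\mathcal{F}_X^{\mathcal{C}}$ with $\alpha_X(w)=A$. $(X,\mathcal{C})$ has the FPP if $\pi_X^{\mathcal{C}}(A)<\infty$ for all $A\in\mathcal{A}_X^{\mathcal{C}}$.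 A cone is an intersection of two open half-planes of $\mathbb{R}^2$ whose bounding lines are not parallel; its vertex is the intersection point of these lines. $X$ satisfies the LC if it is contained in an open half-plane of $\mathbb{R}^2$ bounded by a line through $O$. $\operatorname{Conv}$ denotes convex hull in $\mathbb{R}^2$. -}

module Defs where

open import Level using (Level; 0ℓ; _⊔_)
open import Data.Nat.Base as ℕ using (ℕ)
import Data.Nat.Properties as ℕ
open import Data.Integer.Base as ℤ using (ℤ; 0ℤ)
open import Data.Rational.Base as ℚ using (ℚ; 0ℚ; 1ℚ; ½; ∣_∣; 1/_)
import Data.Rational.Properties as ℚ
open import Data.Rational.Solver using (module +-*-Solver)
open import Data.Fin.Base using (Fin)
open import Data.List.Base using (List; foldr; take; length)
open import Data.List.Membership.Propositional using () renaming (_∈_ to _∈ₗ_)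
open import Data.List.Relation.Unary.All using (All)
open import Data.Product using (Σ-syntax; ∃-syntax; _×_; _,_; proj₁; proj₂)
open import Data.Sum.Base using (_⊎_)
import Data.Vec.Functional as Vector
open import Function.Bundles using (_⇔_)
open import Relation.Binary.PropositionalEquality
  using (_≡_; refl; sym; trans; cong; cong₂; subst)
open import Relation.Unary using (Pred; _∈_; _⊆_; _∩_)

private
  variable
    a x c : Level

------------------------------------------------------------------------
-- Real numbers: Cauchy sequences of rationals, with _≈ᴿ_ as equality

IsCauchy : (ℕ → ℚ) → Set
IsCauchy s = ∀ ε → 0ℚ ℚ.< ε →
  ∃[ N ] (∀ m n → N ℕ.≤ m → N ℕ.≤ n → ∣ s m ℚ.- s n ∣ ℚ.< ε)

record ℝ : Set where
  constructor mkℝ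
  field
    seq    : ℕ → ℚ
    cauchy : IsCauchy seq

open ℝ public

infix  4 _<ᴿ_ _≤ᴿ_ _≈ᴿ_ _#ᴿ_
infixl 6 _+ᴿ_
infixl 7 _*ᴿ_

_<ᴿ_ : ℝ → ℝ → Set
r <ᴿ s = ∃[ ε ] (0ℚ ℚ.< ε × ∃[ N ] (∀ n → N ℕ.≤ n → seq r n ℚ.+ ε ℚ.≤ seq s n))

_≤ᴿ_ : ℝ → ℝ → Set
r ≤ᴿ s = ∀ ε → 0ℚ ℚ.< ε → ∃[ N ] (∀ n → N ℕ.≤ n → seq r n ℚ.≤ seq s n ℚ.+ ε)

_≈ᴿ_ : ℝ → ℝ → Set
r ≈ᴿ s = r ≤ᴿ s × s ≤ᴿ r

-- Apartness, the positive form of "r ≠ s"; classically equivalent to ¬ r ≈ᴿ s.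
_#ᴿ_ : ℝ → ℝ → Set
r #ᴿ s = r <ᴿ s ⊎ s <ᴿ r

private
  ⊔-left : ∀ M N {o} → M ℕ.⊔ N ℕ.≤ o → M ℕ.≤ o
  ⊔-left M N = ℕ.≤-trans (ℕ.m≤m⊔n M N)

  ⊔-right : ∀ M N {o} → M ℕ.⊔ N ℕ.≤ o → N ℕ.≤ o
  ⊔-right M N = ℕ.≤-trans (ℕ.m≤n⊔m M N)

  rearrange-+ : ∀ p q r u → (p ℚ.+ q) ℚ.- (r ℚ.+ u) ≡ (p ℚ.- r) ℚ.+ (q ℚ.- u)
  rearrange-+ = solve 4 (λ p q r u → (p :+ q) :- (r :+ u) := (p :- r) :+ (q :- u)) refl
    where open +-*-Solver

  rearrange-* : ∀ p q r u →
    p ℚ.* q ℚ.- r ℚ.* u ≡ p ℚ.* (q ℚ.- u) ℚ.+ u ℚ.* (p ℚ.- r)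
  rearrange-* = solve 4 (λ p q r u →
    p :* q :- r :* u := p :* (q :- u) :+ u :* (p :- r)) refl
    where open +-*-Solver

  split : ∀ p q → p ≡ (p ℚ.- q) ℚ.+ q
  split = solve 2 (λ p q → p := (p :- q) :+ q) refl
    where open +-*-Solver

  half : ∀ {ε} → 0ℚ ℚ.< ε → 0ℚ ℚ.< ε ℚ.* ½
  half 0<ε = ℚ.*-monoˡ-<-pos ½ 0<ε

  half+half : ∀ ε → ε ℚ.* ½ ℚ.+ ε ℚ.* ½ ≡ ε
  half+half ε = trans (sym (ℚ.*-distribˡ-+ ε ½ ½)) (ℚ.*-identityʳ ε)

  divide : ∀ B η → 0ℚ ℚ.< B → 0ℚ ℚ.< η → ∃[ δ ] (0ℚ ℚ.< δ × B ℚ.* δ ≡ η)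
  divide B η 0<B 0<η = 1/B ℚ.* η
    , ℚ.positive⁻¹ (1/B ℚ.* η) {{ℚ.pos*pos⇒pos 1/B {{pos1/B}} η {{ℚ.positive 0<η}}}}
    , trans (sym (ℚ.*-assoc B 1/B η))
            (trans (cong (ℚ._* η) (ℚ.*-inverseʳ B {{nz}})) (ℚ.*-identityˡ η))
    where
    nz = ℚ.pos⇒nonZero B {{ℚ.positive 0<B}}
    1/B = (1/ B) {{nz}}
    pos1/B = ℚ.1/pos⇒pos B {{ℚ.positive 0<B}}

  +-close : ∀ {p q r u γ δ} → ∣ p ℚ.- r ∣ ℚ.< γ → ∣ q ℚ.- u ∣ ℚ.< δ →
            ∣ (p ℚ.+ q) ℚ.- (r ℚ.+ u) ∣ ℚ.< γ ℚ.+ δ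
  +-close {p} {q} {r} {u} {γ} {δ} h k = begin-strict
    ∣ (p ℚ.+ q) ℚ.- (r ℚ.+ u) ∣       ≡⟨ cong ∣_∣ (rearrange-+ p q r u) ⟩
    ∣ (p ℚ.- r) ℚ.+ (q ℚ.- u) ∣       ≤⟨ ℚ.∣p+q∣≤∣p∣+∣q∣ (p ℚ.- r) (q ℚ.- u) ⟩
    ∣ p ℚ.- r ∣ ℚ.+ ∣ q ℚ.- u ∣       <⟨ ℚ.+-mono-< h k ⟩
    γ ℚ.+ δ                           ∎
    where open ℚ.≤-Reasoning

  *-mono-≤-< : ∀ {B δ} p q → 0ℚ ℚ.< B → ∣ p ∣ ℚ.≤ B → ∣ q ∣ ℚ.< δ →
               ∣ p ℚ.* q ∣ ℚ.< B ℚ.* δ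
  *-mono-≤-< {B} {δ} p q 0<B p≤B q<δ = begin-strict
    ∣ p ℚ.* q ∣       ≡⟨ ℚ.∣p*q∣≡∣p∣*∣q∣ p q ⟩
    ∣ p ∣ ℚ.* ∣ q ∣   ≤⟨ ℚ.*-monoʳ-≤-nonNeg ∣ q ∣ {{ℚ.∣-∣-nonNeg q}} p≤B ⟩
    B ℚ.* ∣ q ∣       <⟨ ℚ.*-monoʳ-<-pos B {{ℚ.positive 0<B}} q<δ ⟩
    B ℚ.* δ           ∎
    where open ℚ.≤-Reasoning

  *-close : ∀ {p q r u B C γ δ} → 0ℚ ℚ.< B → 0ℚ ℚ.< C →
            ∣ p ∣ ℚ.≤ B → ∣ u ∣ ℚ.≤ C → ∣ q ℚ.- u ∣ ℚ.< γ → ∣ p ℚ.- r ∣ ℚ.< δ →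
            ∣ p ℚ.* q ℚ.- r ℚ.* u ∣ ℚ.< B ℚ.* γ ℚ.+ C ℚ.* δ
  *-close {p} {q} {r} {u} {B} {C} {γ} {δ} 0<B 0<C p≤B u≤C h k = begin-strict
    ∣ p ℚ.* q ℚ.- r ℚ.* u ∣
      ≡⟨ cong ∣_∣ (rearrange-* p q r u) ⟩
    ∣ p ℚ.* (q ℚ.- u) ℚ.+ u ℚ.* (p ℚ.- r) ∣
      ≤⟨ ℚ.∣p+q∣≤∣p∣+∣q∣ (p ℚ.* (q ℚ.- u)) (u ℚ.* (p ℚ.- r)) ⟩
    ∣ p ℚ.* (q ℚ.- u) ∣ ℚ.+ ∣ u ℚ.* (p ℚ.- r) ∣
      <⟨ ℚ.+-mono-< (*-mono-≤-< p (q ℚ.- u) 0<B p≤B h)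
                    (*-mono-≤-< u (p ℚ.- r) 0<C u≤C k) ⟩
    B ℚ.* γ ℚ.+ C ℚ.* δ ∎
    where open ℚ.≤-Reasoning

  near⇒bounded : ∀ {p} q → ∣ p ℚ.- q ∣ ℚ.< 1ℚ → ∣ p ∣ ℚ.≤ 1ℚ ℚ.+ ∣ q ∣
  near⇒bounded {p} q h = begin
    ∣ p ∣                     ≡⟨ cong ∣_∣ (split p q) ⟩
    ∣ (p ℚ.- q) ℚ.+ q ∣       ≤⟨ ℚ.∣p+q∣≤∣p∣+∣q∣ (p ℚ.- q) q ⟩
    ∣ p ℚ.- q ∣ ℚ.+ ∣ q ∣     ≤⟨ ℚ.+-monoˡ-≤ ∣ q ∣ (ℚ.<⇒≤ h) ⟩
    1ℚ ℚ.+ ∣ q ∣              ∎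
    where open ℚ.≤-Reasoning

  bounded : ∀ {s} → IsCauchy s →
            ∃[ B ] (0ℚ ℚ.< B × ∃[ N ] (∀ n → N ℕ.≤ n → ∣ s n ∣ ℚ.≤ B))
  bounded {s} cs =
    let N , h = cs 1ℚ (ℚ.positive⁻¹ 1ℚ)
    in 1ℚ ℚ.+ ∣ s N ∣
     , ℚ.+-mono-<-≤ (ℚ.positive⁻¹ 1ℚ) (ℚ.0≤∣p∣ (s N))
     , N , λ n N≤n → near⇒bounded (s N) (h n N N≤n ℕ.≤-refl)

abstract
  const-cauchy : ∀ q → IsCauchy (λ _ → q)
  const-cauchy q ε 0<ε = 0 , λ _ _ _ _ →
    subst (ℚ._< ε) (sym (cong ∣_∣ (ℚ.+-inverseʳ q))) 0<ε

  +-cauchy : ∀ {s t} → IsCauchy s → IsCauchy t → IsCauchy (λ n → s n ℚ.+ t n)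
  +-cauchy {s} {t} cs ct ε 0<ε =
    let M , hs = cs (ε ℚ.* ½) (half 0<ε)
        N , ht = ct (ε ℚ.* ½) (half 0<ε)
    in M ℕ.⊔ N , λ m n ≤m ≤n →
       subst (∣ (s m ℚ.+ t m) ℚ.- (s n ℚ.+ t n) ∣ ℚ.<_) (half+half ε)
         (+-close {s m} {t m} {s n} {t n}
           (hs m n (⊔-left M N ≤m) (⊔-left M N ≤n))
           (ht m n (⊔-right M N ≤m) (⊔-right M N ≤n)))

  *-cauchy : ∀ {s t} → IsCauchy s → IsCauchy t → IsCauchy (λ n → s n ℚ.* t n)
  *-cauchy {s} {t} cs ct ε 0<ε =
    let B , 0<B , K , s≤B = bounded {s} cs
        C , 0<C , L , t≤C = bounded {t} ct
        γ , 0<γ , Bγ≡ = divide B (ε ℚ.* ½) 0<B (half 0<ε)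
        δ , 0<δ , Cδ≡ = divide C (ε ℚ.* ½) 0<C (half 0<ε)
        M , hs = cs δ 0<δ
        N , ht = ct γ 0<γ
    in (K ℕ.⊔ L) ℕ.⊔ (M ℕ.⊔ N) , λ m n ≤m ≤n →
       subst (∣ s m ℚ.* t m ℚ.- s n ℚ.* t n ∣ ℚ.<_)
         (trans (cong₂ ℚ._+_ Bγ≡ Cδ≡) (half+half ε))
         (*-close {s m} {t m} {s n} {t n} 0<B 0<C
           (s≤B m (⊔-left K L (⊔-left (K ℕ.⊔ L) (M ℕ.⊔ N) ≤m)))
           (t≤C n (⊔-right K L (⊔-left (K ℕ.⊔ L) (M ℕ.⊔ N) ≤n)))
           (ht m n (⊔-right M N (⊔-right (K ℕ.⊔ L) (M ℕ.⊔ N) ≤m)) (⊔-right M N (⊔-right (K ℕ.⊔ L) (M ℕ.⊔ N) ≤n)))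
           (hs m n (⊔-left M N (⊔-right (K ℕ.⊔ L) (M ℕ.⊔ N) ≤m)) (⊔-left M N (⊔-right (K ℕ.⊔ L) (M ℕ.⊔ N) ≤n))))

fromℚ : ℚ → ℝ
fromℚ q = mkℝ (λ _ → q) (const-cauchy q)

fromℤ : ℤ → ℝ
fromℤ z = fromℚ (z ℚ./ 1)

0ᴿ 1ᴿ : ℝ
0ᴿ = fromℚ 0ℚ
1ᴿ = fromℚ 1ℚ

_+ᴿ_ : ℝ → ℝ → ℝ
r +ᴿ s = mkℝ (λ n → seq r n ℚ.+ seq s n) (+-cauchy {seq r} {seq s} (cauchy r) (cauchy s))

_*ᴿ_ : ℝ → ℝ → ℝ
r *ᴿ s = mkℝ (λ n → seq r n ℚ.* seq s n) (*-cauchy {seq r} {seq s} (cauchy r) (cauchy s))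

sumᴿ : ∀ {n} → Vector.Vector ℝ n → ℝ
sumᴿ = Vector.foldr _+ᴿ_ 0ᴿ

------------------------------------------------------------------------
-- The lattice ℤ² and the plane ℝ²

ℤ² : Set
ℤ² = ℤ × ℤ

O : ℤ²
O = 0ℤ , 0ℤ

infixl 6 _+²_

_+²_ : ℤ² → ℤ² → ℤ²
(a₁ , a₂) +² (b₁ , b₂) = a₁ ℤ.+ b₁ , a₂ ℤ.+ b₂

ℝ² : Set
ℝ² = ℝ × ℝ

ι : ℤ² → ℝ²
ι (a₁ , a₂) = fromℤ a₁ , fromℤ a₂

infix 4 _≈²_

_≈²_ : ℝ² → ℝ² → Set
(p₁ , p₂) ≈² (q₁ , q₂) = p₁ ≈ᴿ q₁ × p₂ ≈ᴿ q₂

------------------------------------------------------------------------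
-- Half-planes, cones and convex hulls

-- The points (p₁ , p₂) with α p₁ + β p₂ > γ, bounded by the line
-- α p₁ + β p₂ = γ, where (α , β) ≠ (0 , 0).
record OpenHalfPlane : Set where
  field
    α β γ     : ℝ
    nontrivial : α #ᴿ 0ᴿ ⊎ β #ᴿ 0ᴿ

  interior : Pred ℝ² 0ℓ
  interior (p₁ , p₂) = γ <ᴿ α *ᴿ p₁ +ᴿ β *ᴿ p₂

  boundary : Pred ℝ² 0ℓ
  boundary (p₁ , p₂) = α *ᴿ p₁ +ᴿ β *ᴿ p₂ ≈ᴿ γ

record Cone : Set where
  field
    H₁ H₂       : OpenHalfPlane
    nonParallel : OpenHalfPlane.α H₁ *ᴿ OpenHalfPlane.β H₂ #ᴿ
                  OpenHalfPlane.α H₂ *ᴿ OpenHalfPlane.β H₁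

  points : Pred ℝ² 0ℓ
  points = OpenHalfPlane.interior H₁ ∩ OpenHalfPlane.interior H₂

  IsVertex : Pred ℝ² 0ℓ
  IsVertex = OpenHalfPlane.boundary H₁ ∩ OpenHalfPlane.boundary H₂

-- The convex hull in ℝ² of a set of lattice points: all finite convex
-- combinations, with real weights.
Conv : Pred ℤ² x → Pred ℝ² x
Conv X p = ∃[ n ] Σ[ A ∈ (Fin n → ℤ²) ] Σ[ w ∈ (Fin n → ℝ) ]
    (∀ i → A i ∈ X)
  × (∀ i → 0ᴿ ≤ᴿ w i)
  × sumᴿ w ≈ᴿ 1ᴿ
  × ( sumᴿ (λ i → w i *ᴿ proj₁ (ι (A i)))
    , sumᴿ (λ i → w i *ᴿ proj₂ (ι (A i)))) ≈² p

LC : Pred ℤ² x → Set x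
LC X = ∃[ H ] (ι O ∈ OpenHalfPlane.boundary H
             × (∀ {A} → A ∈ X → ι A ∈ OpenHalfPlane.interior H))

------------------------------------------------------------------------
-- Finiteness

Finite : {B : Set} → Pred B a → Set a
Finite P = ∃[ bs ] (∀ b → b ∈ P ⇔ b ∈ₗ bs)

-- Finiteness of a predicate that need not be decidable: the list may also
-- contain elements outside P. Classically equivalent to Finite.
FinitelyMany : {B : Set} → Pred B a → Set a
FinitelyMany P = ∃[ bs ] P ⊆ (_∈ₗ bs)

------------------------------------------------------------------------
-- Constrained walks

record IsSubmonoid (C : Pred ℤ² c) : Set c where
  field
    O∈C      : O ∈ C
    +-closed : ∀ {A B} → A ∈ C → B ∈ C → A +² B ∈ C

Word : Set
Word = List ℤ²

endpoint : Word → ℤ²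
endpoint = foldr _+²_ O

-- 𝓕 X C and 𝓐 X C are the sets F_X^C and A_X^C, and FPP says that
-- π_X^C(A), the number of words in 𝓕 X C ending at A, is always finite.
𝓕 : Pred ℤ² x → Pred ℤ² c → Pred Word (x ⊔ c)
𝓕 X C w = All X w × (∀ m → m ℕ.≤ length w → endpoint (take m w) ∈ C)

𝓐 : Pred ℤ² x → Pred ℤ² c → Pred ℤ² (x ⊔ c)
𝓐 X C A = ∃[ w ] (w ∈ 𝓕 X C × endpoint w ≡ A)

FPP : Pred ℤ² x → Pred ℤ² c → Set (x ⊔ c)
FPP X C = ∀ {A} → A ∈ 𝓐 X C → FinitelyMany (λ w → w ∈ 𝓕 X C × endpoint w ≡ A)

{-# OPTIONS --safe #-}

-- Everything follows from Gordan's alternative for a finite X ⊆ ℤ²: either some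
-- F ∈ ℤ² has F · A > 0 for all A ∈ X, or some nonempty word over X is a closed
-- walk (a Loop). In the first case all three conditions hold: F bounds the
-- length of a word by F · endpoint, separates O from Conv X, and gives the line.
-- In the second case all three fail: equal weights along the loop exhibit O in
-- Conv X; the letters of a word ending at O cannot all lie on one side of a line
-- through O; and for FPP, repeat a word ending in the cone until the whole loop,
-- started there, stays in the cone, after which the loop can be run any number
-- of times without moving the endpoint.
module Submission where

open import Defs
open import Level using (Level)
open import Data.Empty using (⊥-elim)
open import Data.Fin.Base as Fin using (Fin)
open import Data.Integer.Base as ℤ using (ℤ; 0ℤ; 1ℤ; +_; -[1+_])
import Data.Integer.Properties as ℤ
open import Data.Integer.Tactic.RingSolver using (solve-∀)
open import Data.List.Base
  using (List; []; _∷_; _++_; cartesianProductWith; concat; length; lookup; map; replicate; take)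
open import Data.List.Extrema.Nat using (max; xs≤max)
open import Data.List.Membership.Propositional using (find) renaming (_∈_ to _∈ₗ_)
open import Data.List.Membership.Propositional.Properties
  using (∈-cartesianProductWith⁺; ∈-map⁺; ∈-lookup)
open import Data.List.Properties using (length-++-≤ʳ)
open import Data.List.Relation.Unary.All as All using (All; []; _∷_)
open import Data.List.Relation.Unary.All.Properties using (++⁺; replicate⁺; concat⁺; ¬All⇒Any¬)
open import Data.List.Relation.Unary.Any using (here; there)
open import Data.Nat.Base as ℕ using (ℕ; zero; suc)
import Data.Nat.Properties as ℕ
open import Data.Product using (∃-syntax; _×_; _,_; proj₁; proj₂)
open import Data.Rational.Base as ℚ using (ℚ; 0ℚ; 1ℚ; ½; 1/_; ↥_)
import Data.Rational.Properties as ℚ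
open import Data.Rational.Solver using (module +-*-Solver)
import Data.Rational.Unnormalised.Base as ℚᵘ
import Data.Rational.Unnormalised.Properties as ℚᵘ
open import Data.Sum.Base using (_⊎_; inj₁; inj₂)
open import Function.Base using (_∘_)
open import Function.Bundles using (_⇔_; mk⇔; Equivalence)
open import Relation.Binary.Definitions using (tri<; tri≈; tri>)
open import Relation.Binary.PropositionalEquality
open import Relation.Nullary using (¬_; yes; no; contradiction)
open import Relation.Nullary.Decidable using (from-no)
open import Relation.Unary using (Pred; _∈_; _∉_)

private
  variable
    x c : Level
    X : Pred ℤ² x
    C : Pred ℤ² c
    A A′ B P Q : ℤ²

-- Gordan's alternative

infixl 7 _·_ _*²_

_·_ : ℤ² → ℤ² → ℤ
(p , q) · (a , b) = p ℤ.* a ℤ.+ q ℤ.* b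

det : ℤ² → ℤ² → ℤ
det (a , b) (a′ , b′) = a ℤ.* b′ ℤ.- b ℤ.* a′

_*²_ : ℤ → ℤ² → ℤ²
k *² (a , b) = k ℤ.* a , k ℤ.* b

+²-identityˡ : ∀ A → O +² A ≡ A
+²-identityˡ (a , b) = cong₂ _,_ (ℤ.+-identityˡ a) (ℤ.+-identityˡ b)

+²-identityʳ : ∀ A → A +² O ≡ A
+²-identityʳ (a , b) = cong₂ _,_ (ℤ.+-identityʳ a) (ℤ.+-identityʳ b)

+²-assoc : ∀ A B D → A +² B +² D ≡ A +² (B +² D)
+²-assoc (a , b) (a′ , b′) (a″ , b″) = cong₂ _,_ (ℤ.+-assoc a a′ a″) (ℤ.+-assoc b b′ b″)

suc-*² : ∀ n A → (+ suc n) *² A ≡ A +² (+ n) *² A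
suc-*² n (a , b) = cong₂ _,_ (ℤ.suc-* (+ n) a) (ℤ.suc-* (+ n) b)

·-zeroʳ : ∀ F → F · O ≡ 0ℤ
·-zeroʳ (p , q) = cong₂ ℤ._+_ (ℤ.*-zeroʳ p) (ℤ.*-zeroʳ q)

·-distribˡ-+² : ∀ F A B → F · (A +² B) ≡ F · A ℤ.+ F · B
·-distribˡ-+² (p , q) (a , b) (a′ , b′) = identity p q a b a′ b′
  where
  identity : ∀ p q a b a′ b′ → p ℤ.* (a ℤ.+ a′) ℤ.+ q ℤ.* (b ℤ.+ b′) ≡
    p ℤ.* a ℤ.+ q ℤ.* b ℤ.+ (p ℤ.* a′ ℤ.+ q ℤ.* b′)
  identity = solve-∀

endpoint-++ : ∀ u w → endpoint (u ++ w) ≡ endpoint u +² endpoint w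
endpoint-++ []      w = sym (+²-identityˡ (endpoint w))
endpoint-++ (A ∷ u) w =
  trans (cong (A +²_) (endpoint-++ u w)) (sym (+²-assoc A (endpoint u) (endpoint w)))

endpoint-replicate : ∀ n A → endpoint (replicate n A) ≡ (+ n) *² A
endpoint-replicate zero    A = refl
endpoint-replicate (suc n) A =
  trans (cong (A +²_) (endpoint-replicate n A)) (sym (suc-*² n A))

-- Splitting off the letter `A` forces the closed walk to be nonempty.
Loop : Pred ℤ² x → Set x
Loop X = ∃[ A ] ∃[ w ] (All X (A ∷ w) × endpoint (A ∷ w) ≡ O)

-- A vanishing combination becomes a closed walk by writing each letter as often as its coefficient
-- says; `n` being positive makes the word nonempty.
combination⇒Loop : ∀ {n m k} → 0ℤ ℤ.< n → 0ℤ ℤ.≤ m → 0ℤ ℤ.≤ k →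
  A ∈ X → A′ ∈ X → B ∈ X → n *² A +² (m *² A′ +² k *² B) ≡ O → Loop X
combination⇒Loop {A = A} {A′ = A′} {B = B} {n = + suc n} {m = + m} {k = + k} _ _ _ A∈X A′∈X B∈X eq =
  A , replicate n A ++ rest
  , ++⁺ (replicate⁺ (suc n) A∈X) (++⁺ (replicate⁺ m A′∈X) (replicate⁺ k B∈X))
  , (begin
      endpoint (replicate (suc n) A ++ rest)
        ≡⟨ endpoint-++ (replicate (suc n) A) rest ⟩
      endpoint (replicate (suc n) A) +² endpoint rest
        ≡⟨ cong (endpoint (replicate (suc n) A) +²_) (endpoint-++ (replicate m A′) (replicate k B)) ⟩
      endpoint (replicate (suc n) A) +² (endpoint (replicate m A′) +² endpoint (replicate k B))
        ≡⟨ cong₂ _+²_ (endpoint-replicate (suc n) A)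
             (cong₂ _+²_ (endpoint-replicate m A′) (endpoint-replicate k B)) ⟩
      (+ suc n) *² A +² ((+ m) *² A′ +² (+ k) *² B)
        ≡⟨ eq ⟩
      O ∎)
  where
  open ≡-Reasoning
  rest = replicate m A′ ++ replicate k B
combination⇒Loop {n = + zero} (ℤ.+<+ ()) _ _ _ _ _ _

-- A positive integer `f y` is at least 1, so `M` times it outweighs `g y` once `M` exceeds the
-- absolute value of `g y`; the list is finite, so the largest threshold serves every entry.
dominate : ∀ {X : Set} (f g : X → ℤ) xs → All (λ y → 0ℤ ℤ.< f y) xs →
  ∃[ N ] (∀ M → N ℕ.≤ M → All (λ y → 0ℤ ℤ.< (+ M) ℤ.* f y ℤ.+ g y) xs)
dominate f g []       []           = 0 , λ _ _ → []
dominate f g (y ∷ xs) (0<fy ∷ 0<f) =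
  let N , h = dominate f g xs 0<f
      m = suc ℤ.∣ g y ∣
  in m ℕ.⊔ N , λ M ≤M →
     positive (f y) (g y) 0<fy M (ℕ.≤-trans (ℕ.m≤m⊔n m N) ≤M) ∷ h M (ℕ.≤-trans (ℕ.m≤n⊔m m N) ≤M)
  where
  open ℤ.≤-Reasoning
  -∣i∣≤i : ∀ i → ℤ.- (+ ℤ.∣ i ∣) ℤ.≤ i
  -∣i∣≤i (+ zero)  = ℤ.≤-refl
  -∣i∣≤i (+ suc n) = ℤ.-≤+
  -∣i∣≤i -[1+ n ]  = ℤ.≤-refl
  positive : ∀ i j → 0ℤ ℤ.< i → ∀ M → suc ℤ.∣ j ∣ ℕ.≤ M → 0ℤ ℤ.< (+ M) ℤ.* i ℤ.+ j
  positive i j 0<i M j<M = begin-strict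
    0ℤ                               ≡⟨ ℤ.+-inverseʳ (+ ℤ.∣ j ∣) ⟨
    (+ ℤ.∣ j ∣) ℤ.+ ℤ.- (+ ℤ.∣ j ∣)  <⟨ ℤ.+-mono-<-≤ (ℤ.+<+ j<M) (-∣i∣≤i j) ⟩
    (+ M) ℤ.+ j                      ≡⟨ cong (ℤ._+ j) (ℤ.*-identityʳ (+ M)) ⟨
    (+ M) ℤ.* 1ℤ ℤ.+ j               ≤⟨ ℤ.+-monoˡ-≤ j (ℤ.*-monoˡ-≤-nonNeg (+ M) (ℤ.i<j⇒suc[i]≤j 0<i)) ⟩
    (+ M) ℤ.* i ℤ.+ j                ∎

norm : ∀ B → B ≡ O ⊎ 0ℤ ℤ.< B · B
norm (+ zero , + zero)     = inj₁ refl
norm (+ zero , + suc b)    = inj₂ (ℤ.+<+ ℕ.z<s)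
norm (+ zero , -[1+ b ])   = inj₂ (ℤ.+<+ ℕ.z<s)
norm (+ suc a , + zero)    = inj₂ (ℤ.+<+ ℕ.z<s)
norm (+ suc a , + suc b)   = inj₂ (ℤ.+<+ ℕ.z<s)
norm (+ suc a , -[1+ b ])  = inj₂ (ℤ.+<+ ℕ.z<s)
norm (-[1+ a ] , + zero)   = inj₂ (ℤ.+<+ ℕ.z<s)
norm (-[1+ a ] , + suc b)  = inj₂ (ℤ.+<+ ℕ.z<s)
norm (-[1+ a ] , -[1+ b ]) = inj₂ (ℤ.+<+ ℕ.z<s)

-- Determinants and the sides of a line

rotate : ℤ² → ℤ²
rotate (a , b) = ℤ.- b , a

-- For `B` other than `O`, the quarter turn of `B` is thus a functional that vanishes on the line
-- through `O` and `B` and is positive exactly to its left.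
rotate-· : ∀ B A → rotate B · A ≡ det B A
rotate-· (a′ , b′) (a , b) = identity a b a′ b′
  where
  identity : ∀ a b a′ b′ → (ℤ.- b′) ℤ.* a ℤ.+ a′ ℤ.* b ≡ a′ ℤ.* b ℤ.- b′ ℤ.* a
  identity = solve-∀

det-antisym : ∀ A B → det A B ≡ ℤ.- det B A
det-antisym (a , b) (a′ , b′) = identity a b a′ b′
  where
  identity : ∀ a b a′ b′ → a ℤ.* b′ ℤ.- b ℤ.* a′ ≡ ℤ.- (a′ ℤ.* b ℤ.- b′ ℤ.* a)
  identity = solve-∀

-- Reversing the line lets `tilt` also serve when all points lie on its right.
det-neg : ∀ B A → det (ℤ.-1ℤ *² B) A ≡ det A B
det-neg (a′ , b′) (a , b) = identity a b a′ b′
  where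
  identity : ∀ a b a′ b′ → (ℤ.-1ℤ ℤ.* a′) ℤ.* b ℤ.- (ℤ.-1ℤ ℤ.* b′) ℤ.* a ≡ a ℤ.* b′ ℤ.- b ℤ.* a′
  identity = solve-∀

-- For N large, N G + B is positive at B because G vanishes there, and stays
-- positive wherever G is.
tilt : ∀ G B bs → 0ℤ ℤ.< B · B → G · B ≡ 0ℤ → All (λ A → 0ℤ ℤ.< G · A) bs →
  ∃[ F ] All (λ A → 0ℤ ℤ.< F · A) (B ∷ bs)
tilt G B bs 0<BB GB≡0 0<G =
  let N , h = dominate (G ·_) (B ·_) bs 0<G
      expand = λ A → sym (identity G B (+ N) A)
  in (+ N) *² G +² B
   , subst (0ℤ ℤ.<_)
       (trans (sym (trans (cong (λ i → (+ N) ℤ.* i ℤ.+ B · B) GB≡0)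
                          (trans (cong (ℤ._+ B · B) (ℤ.*-zeroʳ (+ N))) (ℤ.+-identityˡ (B · B)))))
              (expand B)) 0<BB
     ∷ All.map (λ {A} → subst (0ℤ ℤ.<_) (expand A)) (h N ℕ.≤-refl)
  where
  solved : ∀ p q p′ q′ n a b → (n ℤ.* p ℤ.+ p′) ℤ.* a ℤ.+ (n ℤ.* q ℤ.+ q′) ℤ.* b ≡
    n ℤ.* (p ℤ.* a ℤ.+ q ℤ.* b) ℤ.+ (p′ ℤ.* a ℤ.+ q′ ℤ.* b)
  solved = solve-∀
  identity : ∀ F G n A → (n *² F +² G) · A ≡ n ℤ.* (F · A) ℤ.+ G · A
  identity (p , q) (p′ , q′) n (a , b) = solved p q p′ q′ n a b

-- Three vectors in the plane are dependent, with their two-by-two minors as coefficients. The signs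
-- are arranged so that all coefficients come out nonnegative in `straddle⇒Loop`.
cramer : ∀ A A′ B → det A B *² A′ +² ((ℤ.- det A′ B) *² A +² (ℤ.- det A A′) *² B) ≡ O
cramer (a , b) (a′ , b′) (d , e) = cong₂ _,_ (first a b a′ b′ d e) (second a b a′ b′ d e)
  where
  first : ∀ a b a′ b′ d e → (a ℤ.* e ℤ.- b ℤ.* d) ℤ.* a′ ℤ.+
    ((ℤ.- (a′ ℤ.* e ℤ.- b′ ℤ.* d)) ℤ.* a ℤ.+ (ℤ.- (a ℤ.* b′ ℤ.- b ℤ.* a′)) ℤ.* d) ≡ 0ℤ
  first = solve-∀
  second : ∀ a b a′ b′ d e → (a ℤ.* e ℤ.- b ℤ.* d) ℤ.* b′ ℤ.+
    ((ℤ.- (a′ ℤ.* e ℤ.- b′ ℤ.* d)) ℤ.* b ℤ.+ (ℤ.- (a ℤ.* b′ ℤ.- b ℤ.* a′)) ℤ.* e) ≡ 0ℤ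
  second = solve-∀

-- Each coordinate of the left side is a multiple of `det A B`. The zero term only brings the
-- relation into the shape that `combination⇒Loop` expects.
parallel : ∀ F A B → det A B ≡ 0ℤ →
  (F · A) *² B +² ((ℤ.- (F · B)) *² A +² 0ℤ *² B) ≡ O
parallel (p , q) (a , b) (d , e) det≡0 = cong₂ _,_
  (trans (first p q a b d e) (trans (cong ((ℤ.- q) ℤ.*_) det≡0) (ℤ.*-zeroʳ (ℤ.- q))))
  (trans (second p q a b d e) (trans (cong (p ℤ.*_) det≡0) (ℤ.*-zeroʳ p)))
  where
  first : ∀ p q a b d e → (p ℤ.* a ℤ.+ q ℤ.* b) ℤ.* d ℤ.+
    ((ℤ.- (p ℤ.* d ℤ.+ q ℤ.* e)) ℤ.* a ℤ.+ 0ℤ ℤ.* d) ≡ (ℤ.- q) ℤ.* (a ℤ.* e ℤ.- b ℤ.* d)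
  first = solve-∀
  second : ∀ p q a b d e → (p ℤ.* a ℤ.+ q ℤ.* b) ℤ.* e ℤ.+
    ((ℤ.- (p ℤ.* d ℤ.+ q ℤ.* e)) ℤ.* b ℤ.+ 0ℤ ℤ.* e) ≡ p ℤ.* (a ℤ.* e ℤ.- b ℤ.* d)
  second = solve-∀

-- Cramer's relation among A, A′ and B is the loop: applying F to it shows that
-- the coefficient of B has the same sign as the other two.
straddle⇒Loop : ∀ F → 0ℤ ℤ.< F · A → 0ℤ ℤ.< F · A′ → F · B ℤ.≤ 0ℤ →
  0ℤ ℤ.≤ det A B → det A′ B ℤ.≤ 0ℤ → A ∈ X → A′ ∈ X → B ∈ X → Loop X
straddle⇒Loop {A = A} {A′ = A′} {B = B} F 0<FA 0<FA′ FB≤0 0≤AB A′B≤0 A∈X A′∈X B∈X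
  with det A B ℤ.≟ 0ℤ
... | yes AB≡0 = combination⇒Loop 0<FA (ℤ.neg-mono-≤ FB≤0) ℤ.≤-refl B∈X A∈X B∈X
                   (parallel F A B AB≡0)
... | no  AB≢0 = combination⇒Loop 0<AB (ℤ.neg-mono-≤ A′B≤0) (ℤ.neg-mono-≤ AA′≤0) A′∈X A∈X B∈X
                   (cramer A A′ B)
  where
  open ℤ.≤-Reasoning
  0<AB : 0ℤ ℤ.< det A B
  0<AB = ℤ.≤∧≢⇒< 0≤AB (AB≢0 ∘ sym)
  scale : ∀ n A → F · (n *² A) ≡ n ℤ.* (F · A)
  scale n (a , b) = identity (proj₁ F) (proj₂ F) n a b
    where
    identity : ∀ p q n a b → p ℤ.* (n ℤ.* a) ℤ.+ q ℤ.* (n ℤ.* b) ≡ n ℤ.* (p ℤ.* a ℤ.+ q ℤ.* b)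
    identity = solve-∀
  *-nonNeg : ∀ {i j} → 0ℤ ℤ.≤ i → 0ℤ ℤ.≤ j → 0ℤ ℤ.≤ i ℤ.* j
  *-nonNeg {i} {j} 0≤i 0≤j = subst (ℤ._≤ i ℤ.* j) (ℤ.*-zeroʳ i)
    (ℤ.*-monoˡ-≤-nonNeg i {{ℤ.nonNegative 0≤i}} 0≤j)
  n = det A B
  m = ℤ.- det A′ B
  AA′≤0 : det A A′ ℤ.≤ 0ℤ
  AA′≤0 = ℤ.≮⇒≥ λ 0<AA′ → ℤ.<-irrefl refl (begin-strict
    0ℤ
      <⟨ subst (ℤ._< n ℤ.* (F · A′)) (ℤ.*-zeroʳ n) (ℤ.*-monoˡ-<-pos n {{ℤ.positive 0<AB}} 0<FA′) ⟩
    n ℤ.* (F · A′)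
      ≡⟨ ℤ.+-identityʳ _ ⟨
    n ℤ.* (F · A′) ℤ.+ (0ℤ ℤ.+ 0ℤ)
      ≤⟨ ℤ.+-monoʳ-≤ (n ℤ.* (F · A′))
           (ℤ.+-mono-≤ (*-nonNeg (ℤ.neg-mono-≤ A′B≤0) (ℤ.<⇒≤ 0<FA))
             (subst (0ℤ ℤ.≤_) (neg-swap (det A A′) (F · B))
               (*-nonNeg (ℤ.<⇒≤ 0<AA′) (ℤ.neg-mono-≤ FB≤0)))) ⟩
    n ℤ.* (F · A′) ℤ.+ (m ℤ.* (F · A) ℤ.+ (ℤ.- det A A′) ℤ.* (F · B))
      ≡⟨ cong₂ ℤ._+_ (scale n A′) (cong₂ ℤ._+_ (scale m A) (scale (ℤ.- det A A′) B)) ⟨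
    F · (n *² A′) ℤ.+ (F · (m *² A) ℤ.+ F · ((ℤ.- det A A′) *² B))
      ≡⟨ cong (λ i → F · (n *² A′) ℤ.+ i) (·-distribˡ-+² F (m *² A) _) ⟨
    F · (n *² A′) ℤ.+ F · (m *² A +² (ℤ.- det A A′) *² B)
      ≡⟨ ·-distribˡ-+² F (n *² A′) _ ⟨
    F · (n *² A′ +² (m *² A +² (ℤ.- det A A′) *² B))
      ≡⟨ cong (F ·_) (cramer A A′ B) ⟩
    F · O
      ≡⟨ ·-zeroʳ F ⟩
    0ℤ ∎)
    where
    neg-swap : ∀ i j → i ℤ.* (ℤ.- j) ≡ (ℤ.- i) ℤ.* j
    neg-swap = solve-∀

det-self : ∀ B → det B B ≡ 0ℤ
det-self (a , b) = identity a b
  where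
  identity : ∀ a b → a ℤ.* b ℤ.- b ℤ.* a ≡ 0ℤ
  identity = solve-∀

Loop-⊆ : ∀ {y} {Y : Pred ℤ² y} → (∀ {A} → A ∈ X → A ∈ Y) → Loop X → Loop Y
Loop-⊆ X⊆Y (A , w , X[Aw] , eq) = A , w , All.map X⊆Y X[Aw] , eq

0<·⇒≢O : ∀ {F A} → 0ℤ ℤ.< F · A → F ≢ O
0<·⇒≢O 0<FA refl = ℤ.<-irrefl refl 0<FA

-- When B is added to bs with F · B ≤ 0, either bs lies strictly on one side of
-- the line OB, and the functional vanishing on that line can be tilted, or two
-- points of bs straddle the line.
gordan : ∀ bs → (∃[ F ] (F ≢ O × All (λ A → 0ℤ ℤ.< F · A) bs)) ⊎ Loop (_∈ₗ bs)
-- `F ≢ O` is carried along because positivity on an empty list does not imply it, while the Line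
-- Condition asks for a genuine line.
gordan []       = inj₁ ((1ℤ , 0ℤ) , (λ ()) , [])
gordan (B ∷ bs) with gordan bs
... | inj₂ loop = inj₂ (Loop-⊆ there loop)
... | inj₁ (F , F≢O , 0<F) with 0ℤ ℤ.<? F · B
...   | yes 0<FB = inj₁ (F , F≢O , 0<FB ∷ 0<F)
...   | no  0≮FB with norm B
...     | inj₁ B≡O = inj₂ (B , [] , here refl ∷ [] , trans (+²-identityʳ B) B≡O)
...     | inj₂ 0<BB with All.all? (λ A → 0ℤ ℤ.<? rotate B · A) bs
                       | All.all? (λ A → 0ℤ ℤ.<? rotate (ℤ.-1ℤ *² B) · A) bs
...       | yes 0<G | _ =
  let F′ , 0<F′ = tilt (rotate B) B bs 0<BB (trans (rotate-· B B) (det-self B)) 0<G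
  in inj₁ (F′ , 0<·⇒≢O {F′} {B} (All.head 0<F′) , 0<F′)
...       | no _ | yes 0<G =
  let F′ , 0<F′ = tilt (rotate (ℤ.-1ℤ *² B)) B bs 0<BB
                    (trans (rotate-· (ℤ.-1ℤ *² B) B) (trans (det-neg B B) (det-self B))) 0<G
  in inj₁ (F′ , 0<·⇒≢O {F′} {B} (All.head 0<F′) , 0<F′)
...       | no ≮₁ | no ≮₂ =
  -- The failed tests supply the straddling points: `A` is not strictly left of the line, and `A′`
  -- is not strictly right of it.
  let A  , A∈bs  , 0≮A  = find (¬All⇒Any¬ (λ A → 0ℤ ℤ.<? rotate B · A) bs ≮₁)
      A′ , A′∈bs , 0≮A′ = find (¬All⇒Any¬ (λ A → 0ℤ ℤ.<? rotate (ℤ.-1ℤ *² B) · A) bs ≮₂)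
  in inj₂ (straddle⇒Loop {A = A} {A′} {B} F (All.lookup 0<F A∈bs) (All.lookup 0<F A′∈bs) (ℤ.≮⇒≥ 0≮FB)
       (subst (0ℤ ℤ.≤_) (sym (trans (det-antisym A B) (cong ℤ.-_ (sym (rotate-· B A)))))
         (ℤ.neg-mono-≤ (ℤ.≮⇒≥ 0≮A)))
       (subst (ℤ._≤ 0ℤ) (trans (rotate-· (ℤ.-1ℤ *² B) A′) (det-neg B A′)) (ℤ.≮⇒≥ 0≮A′))
       (there A∈bs) (there A′∈bs) (here refl))

-- Rational and real inequalities

toℚ : ℤ → ℚ
toℚ z = z ℚ./ 1

private
  -- Normalising `z / 1` involves a gcd that does not reduce for a variable `z`; the laws below are
  -- therefore proved for unnormalised fractions and carried back.
  toℚᵘ-toℚ : ∀ z → ℚ.toℚᵘ (toℚ z) ℚᵘ.≃ ℚᵘ.mkℚᵘ z 0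
  toℚᵘ-toℚ z = ℚ.toℚᵘ-fromℚᵘ (ℚᵘ.mkℚᵘ z 0)

toℚ-+ : ∀ y z → toℚ (y ℤ.+ z) ≡ toℚ y ℚ.+ toℚ z
toℚ-+ y z = ℚ.toℚᵘ-injective (begin
  ℚ.toℚᵘ (toℚ (y ℤ.+ z))                  ≈⟨ toℚᵘ-toℚ (y ℤ.+ z) ⟩
  ℚᵘ.mkℚᵘ (y ℤ.+ z) 0                     ≈⟨ ℚᵘ.*≡* (identity y z) ⟩
  ℚᵘ.mkℚᵘ y 0 ℚᵘ.+ ℚᵘ.mkℚᵘ z 0            ≈⟨ ℚᵘ.+-cong (toℚᵘ-toℚ y) (toℚᵘ-toℚ z) ⟨
  ℚ.toℚᵘ (toℚ y) ℚᵘ.+ ℚ.toℚᵘ (toℚ z)      ≈⟨ ℚ.toℚᵘ-homo-+ (toℚ y) (toℚ z) ⟨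
  ℚ.toℚᵘ (toℚ y ℚ.+ toℚ z)                ∎)
  where
  open ℚᵘ.≃-Reasoning
  identity : ∀ y z → (y ℤ.+ z) ℤ.* 1ℤ ≡ (y ℤ.* 1ℤ ℤ.+ z ℤ.* 1ℤ) ℤ.* 1ℤ
  identity = solve-∀

toℚ-* : ∀ y z → toℚ (y ℤ.* z) ≡ toℚ y ℚ.* toℚ z
toℚ-* y z = ℚ.toℚᵘ-injective (begin
  ℚ.toℚᵘ (toℚ (y ℤ.* z))                  ≈⟨ toℚᵘ-toℚ (y ℤ.* z) ⟩
  ℚᵘ.mkℚᵘ (y ℤ.* z) 0                     ≈⟨ ℚᵘ.*≡* refl ⟩
  ℚᵘ.mkℚᵘ y 0 ℚᵘ.* ℚᵘ.mkℚᵘ z 0            ≈⟨ ℚᵘ.*-cong (toℚᵘ-toℚ y) (toℚᵘ-toℚ z) ⟨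
  ℚ.toℚᵘ (toℚ y) ℚᵘ.* ℚ.toℚᵘ (toℚ z)      ≈⟨ ℚ.toℚᵘ-homo-* (toℚ y) (toℚ z) ⟨
  ℚ.toℚᵘ (toℚ y ℚ.* toℚ z)                ∎)
  where open ℚᵘ.≃-Reasoning

toℚ-mono-≤ : ∀ {y z} → y ℤ.≤ z → toℚ y ℚ.≤ toℚ z
toℚ-mono-≤ {y} {z} y≤z = ℚ.toℚᵘ-cancel-≤ (begin
  ℚ.toℚᵘ (toℚ y)  ≃⟨ toℚᵘ-toℚ y ⟩
  ℚᵘ.mkℚᵘ y 0     ≤⟨ ℚᵘ.*≤* (ℤ.*-monoʳ-≤-nonNeg 1ℤ y≤z) ⟩
  ℚᵘ.mkℚᵘ z 0     ≃⟨ toℚᵘ-toℚ z ⟨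
  ℚ.toℚᵘ (toℚ z)  ∎)
  where open ℚᵘ.≤-Reasoning

toℚ-mono-< : ∀ {y z} → y ℤ.< z → toℚ y ℚ.< toℚ z
toℚ-mono-< {y} {z} y<z = ℚ.toℚᵘ-cancel-< (begin-strict
  ℚ.toℚᵘ (toℚ y)  ≃⟨ toℚᵘ-toℚ y ⟩
  ℚᵘ.mkℚᵘ y 0     <⟨ ℚᵘ.*<* (ℤ.*-monoʳ-<-pos 1ℤ y<z) ⟩
  ℚᵘ.mkℚᵘ z 0     ≃⟨ toℚᵘ-toℚ z ⟨
  ℚ.toℚᵘ (toℚ z)  ∎)
  where open ℚᵘ.≤-Reasoning

0<1ℚ : 0ℚ ℚ.< 1ℚ
0<1ℚ = ℚ.positive⁻¹ 1ℚ

quotient : ∀ q r → 0ℚ ℚ.< r → ∃[ s ] s ℚ.* r ≡ q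
quotient q r 0<r = q ℚ.* 1/r ,
  trans (ℚ.*-assoc q 1/r r)
    (trans (cong (q ℚ.*_) (ℚ.*-inverseˡ r {{r≢0}})) (ℚ.*-identityʳ q))
  where
  r≢0 = ℚ.pos⇒nonZero r {{ℚ.positive 0<r}}
  1/r = (1/ r) {{r≢0}}

quotient-pos : ∀ {s r} → 0ℚ ℚ.< r → 0ℚ ℚ.< s ℚ.* r → 0ℚ ℚ.< s
quotient-pos {s} {r} 0<r 0<sr = ℚ.*-cancelʳ-<-nonNeg r
  {{ℚ.pos⇒nonNeg r {{ℚ.positive 0<r}}}}
  (subst (ℚ._< s ℚ.* r) (sym (ℚ.*-zeroˡ r)) 0<sr)

-- The denominator is at least 1, so dropping it cannot decrease the absolute value.
p≤toℚ∣↥p∣ : ∀ p → p ℚ.≤ toℚ (+ ℤ.∣ ↥ p ∣)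
p≤toℚ∣↥p∣ p@record{} = ℚ.toℚᵘ-cancel-≤ (begin
  ℚ.toℚᵘ p                        ≤⟨ ℚᵘ.*≤* (bound (↥ p) (ℚ.denominator-1 p)) ⟩
  ℚᵘ.mkℚᵘ (+ ℤ.∣ ↥ p ∣) 0         ≃⟨ toℚᵘ-toℚ (+ ℤ.∣ ↥ p ∣) ⟨
  ℚ.toℚᵘ (toℚ (+ ℤ.∣ ↥ p ∣))      ∎)
  where
  open ℚᵘ.≤-Reasoning
  bound : ∀ i d → i ℤ.* 1ℤ ℤ.≤ (+ ℤ.∣ i ∣) ℤ.* (+ suc d)
  bound (+ n) d = ℤ.*-monoˡ-≤-nonNeg (+ n) (ℤ.+≤+ (ℕ.s≤s ℕ.z≤n))
  bound -[1+ n ] d = ℤ.-≤+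

archimedean : ∀ q r → 0ℚ ℚ.< r → ∃[ k ] q ℚ.≤ toℚ (+ k) ℚ.* r
archimedean q r 0<r =
  let s , sr≡q = quotient q r 0<r
  in ℤ.∣ ↥ s ∣ , subst (ℚ._≤ toℚ (+ ℤ.∣ ↥ s ∣) ℚ.* r) sr≡q
       (ℚ.*-monoʳ-≤-nonNeg r {{ℚ.pos⇒nonNeg r {{ℚ.positive 0<r}}}} (p≤toℚ∣↥p∣ s))

p≤∣p∣ : ∀ p → p ℚ.≤ ℚ.∣ p ∣
p≤∣p∣ p with ℚ.≤-total 0ℚ p
... | inj₁ 0≤p = ℚ.≤-reflexive (sym (ℚ.0≤p⇒∣p∣≡p 0≤p))
... | inj₂ p≤0 = ℚ.≤-trans p≤0 (ℚ.0≤∣p∣ p)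

half-pos : ∀ {ε} → 0ℚ ℚ.< ε → 0ℚ ℚ.< ε ℚ.* ½
half-pos = ℚ.*-monoˡ-<-pos ½

half+half≡ : ∀ ε → ε ℚ.* ½ ℚ.+ ε ℚ.* ½ ≡ ε
half+half≡ ε = trans (sym (ℚ.*-distribˡ-+ ε ½ ½)) (ℚ.*-identityʳ ε)

-- Order on the Cauchy reals

pointwise-≤⇒≤ᴿ : ∀ {r s} → (∀ n → seq r n ℚ.≤ seq s n) → r ≤ᴿ s
pointwise-≤⇒≤ᴿ {r} {s} r≤s ε 0<ε = 0 , λ n _ →
  subst (ℚ._≤ seq s n ℚ.+ ε) (ℚ.+-identityʳ (seq r n)) (ℚ.+-mono-≤ (r≤s n) (ℚ.<⇒≤ 0<ε))

pointwise-≡⇒≤ᴿ : ∀ {r s} → (∀ n → seq r n ≡ seq s n) → r ≤ᴿ s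
pointwise-≡⇒≤ᴿ {r} {s} r≡s = pointwise-≤⇒≤ᴿ {r} {s} (λ n → ℚ.≤-reflexive (r≡s n))

-- Algebraic identities between reals are checked through this as ring identities in ℚ, index by
-- index.
pointwise-≡⇒≈ᴿ : ∀ {r s} → (∀ n → seq r n ≡ seq s n) → r ≈ᴿ s
pointwise-≡⇒≈ᴿ {r} {s} r≡s = pointwise-≡⇒≤ᴿ {r} {s} r≡s , pointwise-≡⇒≤ᴿ {s} {r} (λ n → sym (r≡s n))

private
  halve : ∀ q ε → q ℚ.+ ε ℚ.* ½ ℚ.+ ε ℚ.* ½ ≡ q ℚ.+ ε
  halve q ε = trans (ℚ.+-assoc q (ε ℚ.* ½) (ε ℚ.* ½)) (cong (q ℚ.+_) (half+half≡ ε))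

≤ᴿ-trans : ∀ {r s t} → r ≤ᴿ s → s ≤ᴿ t → r ≤ᴿ t
≤ᴿ-trans {r} {s} {t} r≤s s≤t ε 0<ε =
  let M , f = r≤s (ε ℚ.* ½) (half-pos 0<ε)
      N , g = s≤t (ε ℚ.* ½) (half-pos 0<ε)
  in M ℕ.⊔ N , λ n ≤n → begin
    seq r n                             ≤⟨ f n (ℕ.m⊔n≤o⇒m≤o M N ≤n) ⟩
    seq s n ℚ.+ ε ℚ.* ½                 ≤⟨ ℚ.+-monoˡ-≤ (ε ℚ.* ½) (g n (ℕ.m⊔n≤o⇒n≤o M N ≤n)) ⟩
    seq t n ℚ.+ ε ℚ.* ½ ℚ.+ ε ℚ.* ½     ≡⟨ halve (seq t n) ε ⟩
    seq t n ℚ.+ ε                       ∎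
  where open ℚ.≤-Reasoning

+ᴿ-mono-≤ᴿ : ∀ {r s t u} → r ≤ᴿ s → t ≤ᴿ u → r +ᴿ t ≤ᴿ s +ᴿ u
+ᴿ-mono-≤ᴿ {r} {s} {t} {u} r≤s t≤u ε 0<ε =
  let M , f = r≤s (ε ℚ.* ½) (half-pos 0<ε)
      N , g = t≤u (ε ℚ.* ½) (half-pos 0<ε)
  in M ℕ.⊔ N , λ n ≤n → begin
    seq r n ℚ.+ seq t n
      ≤⟨ ℚ.+-mono-≤ (f n (ℕ.m⊔n≤o⇒m≤o M N ≤n)) (g n (ℕ.m⊔n≤o⇒n≤o M N ≤n)) ⟩
    (seq s n ℚ.+ ε ℚ.* ½) ℚ.+ (seq u n ℚ.+ ε ℚ.* ½)
      ≡⟨ rearrange (seq s n) (seq u n) (ε ℚ.* ½) ⟩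
    (seq s n ℚ.+ seq u n) ℚ.+ ε ℚ.* ½ ℚ.+ ε ℚ.* ½
      ≡⟨ halve (seq s n ℚ.+ seq u n) ε ⟩
    (seq s n ℚ.+ seq u n) ℚ.+ ε ∎
  where
  open ℚ.≤-Reasoning
  rearrange : ∀ p q r → (p ℚ.+ r) ℚ.+ (q ℚ.+ r) ≡ p ℚ.+ q ℚ.+ r ℚ.+ r
  rearrange = solve 3 (λ p q r → (p :+ r) :+ (q :+ r) := p :+ q :+ r :+ r) refl
    where open +-*-Solver

sumᴿ-mono-≤ᴿ : ∀ {n} {f g : Fin n → ℝ} → (∀ i → f i ≤ᴿ g i) → sumᴿ f ≤ᴿ sumᴿ g
sumᴿ-mono-≤ᴿ {zero}          f≤g = pointwise-≤⇒≤ᴿ {0ᴿ} {0ᴿ} (λ _ → ℚ.≤-refl)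
sumᴿ-mono-≤ᴿ {suc n} {f} {g} f≤g =
  +ᴿ-mono-≤ᴿ {f Fin.zero} {g Fin.zero} {sumᴿ (f ∘ Fin.suc)} {sumᴿ (g ∘ Fin.suc)}
    (f≤g Fin.zero) (sumᴿ-mono-≤ᴿ (f≤g ∘ Fin.suc))

*ᴿ-monoʳ-nonNeg : ∀ {r s} c → 0ℚ ℚ.≤ c → r ≤ᴿ s → r *ᴿ fromℚ c ≤ᴿ s *ᴿ fromℚ c
*ᴿ-monoʳ-nonNeg {r} {s} c 0≤c r≤s ε 0<ε =
  -- Dividing by `1 + c` instead of `c` avoids a separate case for `c = 0`; the spare `δ` is given
  -- away in the chain below.
  let δ , δ[1+c]≡ε = quotient ε (1ℚ ℚ.+ c) 0<1+c
      0<δ = quotient-pos 0<1+c (subst (0ℚ ℚ.<_) (sym δ[1+c]≡ε) 0<ε)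
      N , f = r≤s δ 0<δ
  in N , λ n ≤n → begin
    seq r n ℚ.* c                          ≤⟨ ℚ.*-monoʳ-≤-nonNeg c {{ℚ.nonNegative 0≤c}} (f n ≤n) ⟩
    (seq s n ℚ.+ δ) ℚ.* c                  ≡⟨ ℚ.+-identityˡ _ ⟨
    0ℚ ℚ.+ (seq s n ℚ.+ δ) ℚ.* c           ≤⟨ ℚ.+-monoˡ-≤ ((seq s n ℚ.+ δ) ℚ.* c) (ℚ.<⇒≤ 0<δ) ⟩
    δ ℚ.+ (seq s n ℚ.+ δ) ℚ.* c            ≡⟨ rearrange (seq s n) δ c ⟩
    seq s n ℚ.* c ℚ.+ δ ℚ.* (1ℚ ℚ.+ c)     ≡⟨ cong (seq s n ℚ.* c ℚ.+_) δ[1+c]≡ε ⟩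
    seq s n ℚ.* c ℚ.+ ε                    ∎
  where
  open ℚ.≤-Reasoning
  0<1+c = ℚ.+-mono-<-≤ 0<1ℚ 0≤c
  rearrange : ∀ p q r → q ℚ.+ (p ℚ.+ q) ℚ.* r ≡ p ℚ.* r ℚ.+ q ℚ.* (1ℚ ℚ.+ r)
  rearrange = solve 3 (λ p q r → q :+ (p :+ q) :* r := p :* r :+ q :* (con 1ℚ :+ r)) refl
    where open +-*-Solver

*ᴿ-monoʳ-nonPos : ∀ {r s} c → c ℚ.≤ 0ℚ → s ≤ᴿ r → r *ᴿ fromℚ c ≤ᴿ s *ᴿ fromℚ c
*ᴿ-monoʳ-nonPos {r} {s} c c≤0 s≤r ε 0<ε =
  -- Use the nonnegative factor `- c`, then add `r c + s c` to both sides.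
  let N , f = *ᴿ-monoʳ-nonNeg {s} {r} (ℚ.- c) (ℚ.neg-antimono-≤ c≤0) s≤r ε 0<ε
  in N , λ n ≤n → begin
    seq r n ℚ.* c
      ≡⟨ first (seq r n) (seq s n) c ⟩
    seq s n ℚ.* (ℚ.- c) ℚ.+ (seq r n ℚ.* c ℚ.+ seq s n ℚ.* c)
      ≤⟨ ℚ.+-monoˡ-≤ (seq r n ℚ.* c ℚ.+ seq s n ℚ.* c) (f n ≤n) ⟩
    (seq r n ℚ.* (ℚ.- c) ℚ.+ ε) ℚ.+ (seq r n ℚ.* c ℚ.+ seq s n ℚ.* c)
      ≡⟨ second (seq r n) (seq s n) c ε ⟩
    seq s n ℚ.* c ℚ.+ ε ∎
  where
  open ℚ.≤-Reasoning
  open +-*-Solver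
  first : ∀ r s c → r ℚ.* c ≡ s ℚ.* (ℚ.- c) ℚ.+ (r ℚ.* c ℚ.+ s ℚ.* c)
  first = solve 3 (λ r s c → r :* c := s :* (:- c) :+ (r :* c :+ s :* c)) refl
  second : ∀ r s c ε → (r ℚ.* (ℚ.- c) ℚ.+ ε) ℚ.+ (r ℚ.* c ℚ.+ s ℚ.* c) ≡ s ℚ.* c ℚ.+ ε
  second = solve 4 (λ r s c ε → (r :* (:- c) :+ ε) :+ (r :* c :+ s :* c) := s :* c :+ ε) refl

-- The factor will be a coordinate of `F`, of unknown sign; each sign uses one of the two
-- inequalities in `≈ᴿ`.
≈ᴿ⇒*ᴿ-≤ᴿ : ∀ {r s} c → r ≈ᴿ s → r *ᴿ fromℚ c ≤ᴿ s *ᴿ fromℚ c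
≈ᴿ⇒*ᴿ-≤ᴿ {r} {s} c (r≤s , s≤r) with ℚ.≤-total 0ℚ c
... | inj₁ 0≤c = *ᴿ-monoʳ-nonNeg {r} {s} c 0≤c r≤s
... | inj₂ c≤0 = *ᴿ-monoʳ-nonPos {r} {s} c c≤0 s≤r

1≰0 : ¬ (1ᴿ ≤ᴿ 0ᴿ)
1≰0 1≤0 =
  let N , f = 1≤0 ½ (ℚ.positive⁻¹ ½)
  in from-no (1ℚ ℚ.≤? 0ℚ ℚ.+ ½) (f N ℕ.≤-refl)

-- Scale `0 ≤ w` by the nonnegative `c - 1` and add `w`.
weight-≤ᴿ : ∀ {w} c → 1ℚ ℚ.≤ c → 0ᴿ ≤ᴿ w → w ≤ᴿ w *ᴿ fromℚ c
weight-≤ᴿ {w} c 1≤c 0≤w ε 0<ε =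
  let N , f = *ᴿ-monoʳ-nonNeg {0ᴿ} {w} (c ℚ.- 1ℚ) 0≤c-1 0≤w ε 0<ε
  in N , λ n ≤n → begin
    seq w n                                           ≡⟨ first (seq w n) c ⟩
    0ℚ ℚ.* (c ℚ.- 1ℚ) ℚ.+ seq w n                     ≤⟨ ℚ.+-monoˡ-≤ (seq w n) (f n ≤n) ⟩
    (seq w n ℚ.* (c ℚ.- 1ℚ) ℚ.+ ε) ℚ.+ seq w n        ≡⟨ second (seq w n) c ε ⟩
    seq w n ℚ.* c ℚ.+ ε                               ∎
  where
  open ℚ.≤-Reasoning
  open +-*-Solver
  0≤c-1 : 0ℚ ℚ.≤ c ℚ.- 1ℚ
  0≤c-1 = subst (ℚ._≤ c ℚ.- 1ℚ) (ℚ.+-inverseʳ 1ℚ) (ℚ.+-monoˡ-≤ (ℚ.- 1ℚ) 1≤c)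
  first : ∀ w c → w ≡ 0ℚ ℚ.* (c ℚ.- 1ℚ) ℚ.+ w
  first = solve 2 (λ w c → w := con 0ℚ :* (c :- con 1ℚ) :+ w) refl
  second : ∀ w c ε → (w ℚ.* (c ℚ.- 1ℚ) ℚ.+ ε) ℚ.+ w ≡ w ℚ.* c ℚ.+ ε
  second = solve 3 (λ w c ε → (w :* (c :- con 1ℚ) :+ ε) :+ w := w :* c :+ ε) refl

-- Consequences of a positive functional

Positive : ℤ² → Pred ℤ² x → Set x
Positive F X = ∀ {A} → A ∈ X → 0ℤ ℤ.< F · A

toℚ-· : ∀ p q a b → toℚ ((p , q) · (a , b)) ≡ toℚ p ℚ.* toℚ a ℚ.+ toℚ q ℚ.* toℚ b
toℚ-· p q a b = trans (toℚ-+ (p ℤ.* a) (q ℤ.* b)) (cong₂ ℚ._+_ (toℚ-* p a) (toℚ-* q b))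

-- By integrality `F` is at least 1 on `X`. A convex combination equal to `O` would give 1 = Σ wᵢ ≤
-- Σ wᵢ (F · Aᵢ) = F · O = 0, the middle equality by linearity.
positive⇒O∉Conv : ∀ F → Positive F X → ι O ∉ Conv X
positive⇒O∉Conv {X = X} F@(p , q) 0<F (n , A , w , A∈X , 0≤w , (_ , 1≤Σw) , Σx≈0 , Σy≈0) =
  1≰0 (≤ᴿ-trans {1ᴿ} {sumᴿ w} {0ᴿ} 1≤Σw
      (≤ᴿ-trans {sumᴿ w} {sumᴿ wF} {0ᴿ} (sumᴿ-mono-≤ᴿ {n} {w} {wF} w≤wF)
      (≤ᴿ-trans {sumᴿ wF} {sumᴿ wx *ᴿ fromℤ p +ᴿ sumᴿ wy *ᴿ fromℤ q} {0ᴿ}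
        (pointwise-≡⇒≤ᴿ {sumᴿ wF} {sumᴿ wx *ᴿ fromℤ p +ᴿ sumᴿ wy *ᴿ fromℤ q} (linear A w))
      (≤ᴿ-trans {sumᴿ wx *ᴿ fromℤ p +ᴿ sumᴿ wy *ᴿ fromℤ q} {0ᴿ *ᴿ fromℤ p +ᴿ 0ᴿ *ᴿ fromℤ q} {0ᴿ}
        (+ᴿ-mono-≤ᴿ {sumᴿ wx *ᴿ fromℤ p} {0ᴿ *ᴿ fromℤ p} {sumᴿ wy *ᴿ fromℤ q} {0ᴿ *ᴿ fromℤ q}
          (≈ᴿ⇒*ᴿ-≤ᴿ {sumᴿ wx} {0ᴿ} (toℚ p) Σx≈0) (≈ᴿ⇒*ᴿ-≤ᴿ {sumᴿ wy} {0ᴿ} (toℚ q) Σy≈0))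
        (pointwise-≡⇒≤ᴿ {0ᴿ *ᴿ fromℤ p +ᴿ 0ᴿ *ᴿ fromℤ q} {0ᴿ}
          (λ _ → cong₂ ℚ._+_ (ℚ.*-zeroˡ (toℚ p)) (ℚ.*-zeroˡ (toℚ q))))))))
  where
  wF wx wy : Fin n → ℝ
  wF i = w i *ᴿ fromℤ (F · A i)
  wx i = w i *ᴿ fromℤ (proj₁ (A i))
  wy i = w i *ᴿ fromℤ (proj₂ (A i))
  w≤wF : ∀ i → w i ≤ᴿ wF i
  w≤wF i = weight-≤ᴿ {w i} (toℚ (F · A i)) (toℚ-mono-≤ (ℤ.i<j⇒suc[i]≤j (0<F (A∈X i)))) (0≤w i)
  linear : ∀ {n} (A : Fin n → ℤ²) (w : Fin n → ℝ) k →
    seq (sumᴿ (λ i → w i *ᴿ fromℤ (F · A i))) k ≡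
    seq (sumᴿ (λ i → w i *ᴿ fromℤ (proj₁ (A i)))) k ℚ.* toℚ p ℚ.+
    seq (sumᴿ (λ i → w i *ᴿ fromℤ (proj₂ (A i)))) k ℚ.* toℚ q
  linear {zero}  A w k = sym (cong₂ ℚ._+_ (ℚ.*-zeroˡ (toℚ p)) (ℚ.*-zeroˡ (toℚ q)))
  linear {suc n} A w k = trans
    (cong₂ ℚ._+_ (cong (seq (w Fin.zero) k ℚ.*_) (toℚ-· p q (proj₁ (A Fin.zero)) (proj₂ (A Fin.zero))))
      (linear (A ∘ Fin.suc) (w ∘ Fin.suc) k))
    (identity (seq (w Fin.zero) k) (toℚ p) (toℚ q) (toℚ (proj₁ (A Fin.zero))) (toℚ (proj₂ (A Fin.zero))) _ _)
    where
    identity : ∀ w p q a b s t → w ℚ.* (p ℚ.* a ℚ.+ q ℚ.* b) ℚ.+ (s ℚ.* p ℚ.+ t ℚ.* q) ≡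
      (w ℚ.* a ℚ.+ s) ℚ.* p ℚ.+ (w ℚ.* b ℚ.+ t) ℚ.* q
    identity = solve 7 (λ w p q a b s t → w :* (p :* a :+ q :* b) :+ (s :* p :+ t :* q) :=
      (w :* a :+ s) :* p :+ (w :* b :+ t) :* q) refl
      where open +-*-Solver

positive⇒LC : ∀ F → F ≢ O → Positive F X → LC X
positive⇒LC F@(p , q) F≢O 0<F =
  record { α = fromℤ p ; β = fromℤ q ; γ = 0ᴿ ; nontrivial = nontrivial p q F≢O }
  , pointwise-≡⇒≈ᴿ {fromℤ p *ᴿ fromℤ 0ℤ +ᴿ fromℤ q *ᴿ fromℤ 0ℤ} {0ᴿ}
      (λ _ → cong₂ ℚ._+_ (ℚ.*-zeroʳ (toℚ p)) (ℚ.*-zeroʳ (toℚ q)))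
  -- A positive integer is at least 1, so the strict inequality holds with gap 1 from index 0 on.
  , λ {A} A∈X → 1ℚ , 0<1ℚ , 0 , λ _ _ →
      subst (1ℚ ℚ.≤_) (toℚ-· p q (proj₁ A) (proj₂ A))
        (toℚ-mono-≤ (ℤ.i<j⇒suc[i]≤j (0<F A∈X)))
  where
  apart : ∀ z → z ≢ 0ℤ → fromℤ z #ᴿ 0ᴿ
  apart z z≢0 with ℤ.<-cmp z 0ℤ
  ... | tri≈ _ z≡0 _ = contradiction z≡0 z≢0
  ... | tri> _ _ 0<z = inj₂ (1ℚ , 0<1ℚ , 0 , λ _ _ → toℚ-mono-≤ (ℤ.i<j⇒suc[i]≤j 0<z))
  ... | tri< z<0 _ _ = inj₁ (1ℚ , 0<1ℚ , 0 , λ _ _ →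
    subst (ℚ._≤ 0ℚ) (trans (toℚ-+ 1ℤ z) (ℚ.+-comm 1ℚ (toℚ z)))
      (toℚ-mono-≤ (ℤ.i<j⇒suc[i]≤j z<0)))
  nontrivial : ∀ p q → (p , q) ≢ O → fromℤ p #ᴿ 0ᴿ ⊎ fromℤ q #ᴿ 0ᴿ
  nontrivial p q pq≢O with p ℤ.≟ 0ℤ
  ... | no p≢0   = inj₁ (apart p p≢0)
  ... | yes refl = inj₂ (apart q (pq≢O ∘ cong (0ℤ ,_)))

-- Words of bounded length

words : List ℤ² → ℕ → List Word
words bs zero    = [] ∷ []
words bs (suc n) = [] ∷ cartesianProductWith _∷_ bs (words bs n)

∈-words : ∀ {bs n w} → All (_∈ₗ bs) w → length w ℕ.≤ n → w ∈ₗ words bs n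
∈-words {n = zero}  []             _         = here refl
∈-words {n = suc n} []             _         = here refl
∈-words {n = suc n} (A∈bs ∷ w∈bs) (ℕ.s≤s l) =
  there (∈-cartesianProductWith⁺ _∷_ A∈bs (∈-words w∈bs l))

-- Each letter adds at least 1 to the value of `F` along the walk.
positive⇒length≤ : ∀ F {w} → Positive F X → All X w → (+ length w) ℤ.≤ F · endpoint w
positive⇒length≤ F 0<F [] = ℤ.≤-reflexive (sym (·-zeroʳ F))
positive⇒length≤ F {A ∷ w} 0<F (A∈X ∷ w∈X) = subst (ℤ._≤_ (+ suc (length w)))
  (sym (·-distribˡ-+² F A (endpoint w)))
  (ℤ.+-mono-≤ (ℤ.i<j⇒suc[i]≤j (0<F A∈X)) (positive⇒length≤ F 0<F w∈X))

positive⇒FPP : Finite X → ∀ F → Positive F X → FPP X C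
positive⇒FPP (bs , X⇔bs) F 0<F {A} _ =
  -- `FinitelyMany` admits extra entries, so all words up to the length bound may be listed, whether
  -- or not they stay in `C`.
  words bs ℤ.∣ F · A ∣ , λ { ((w∈X , _) , refl) →
    ∈-words (All.map (Equivalence.to (X⇔bs _)) w∈X)
      (ℤ.drop‿+≤+ (ℤ.≤-trans (positive⇒length≤ F 0<F w∈X) (i≤∣i∣ (F · A)))) }
  where
  i≤∣i∣ : ∀ i → i ℤ.≤ + ℤ.∣ i ∣
  i≤∣i∣ (+ n)    = ℤ.≤-refl
  i≤∣i∣ -[1+ n ] = ℤ.-≤+

-- Consequences of a loop

Loop⇒O∈Conv : Loop X → ι O ∈ Conv X
Loop⇒O∈Conv {X = X} (A , w , X[Aw] , eq) =
  -- The common weight `s` is the reciprocal of the length, which is positive because a loop is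
  -- nonempty.
  let s , sn≡1 = quotient 1ℚ (toℚ (+ length Aw)) 0<n
      0<s = quotient-pos 0<n (subst (0ℚ ℚ.<_) (sym sn≡1) 0<1ℚ)
  in length Aw , lookup Aw , (λ _ → fromℚ s)
   , (λ i → All.lookup X[Aw] (∈-lookup i))
   , (λ _ → pointwise-≤⇒≤ᴿ {0ᴿ} {fromℚ s} (λ _ → ℚ.<⇒≤ 0<s))
   , pointwise-≡⇒≈ᴿ {sumᴿ {length Aw} (λ _ → fromℚ s)} {1ᴿ} (λ k → trans (sum-const s Aw k) sn≡1)
   , pointwise-≡⇒≈ᴿ {sumᴿ (λ i → fromℚ s *ᴿ fromℤ (proj₁ (lookup Aw i)))} {0ᴿ}
       (λ k → trans (sum₁ s Aw k) (trans (cong (λ P → s ℚ.* toℚ (proj₁ P)) eq) (ℚ.*-zeroʳ s)))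
   , pointwise-≡⇒≈ᴿ {sumᴿ (λ i → fromℚ s *ᴿ fromℤ (proj₂ (lookup Aw i)))} {0ᴿ}
       (λ k → trans (sum₂ s Aw k) (trans (cong (λ P → s ℚ.* toℚ (proj₂ P)) eq) (ℚ.*-zeroʳ s)))
  where
  Aw = A ∷ w
  0<n : 0ℚ ℚ.< toℚ (+ length Aw)
  0<n = toℚ-mono-< {0ℤ} {+ length Aw} (ℤ.+<+ ℕ.z<s)
  distrib : ∀ s y z → s ℚ.* toℚ y ℚ.+ s ℚ.* toℚ z ≡ s ℚ.* toℚ (y ℤ.+ z)
  distrib s y z = sym (trans (cong (s ℚ.*_) (toℚ-+ y z)) (ℚ.*-distribˡ-+ s (toℚ y) (toℚ z)))
  sum-const : ∀ s (l : Word) k → seq (sumᴿ {length l} (λ _ → fromℚ s)) k ≡ s ℚ.* toℚ (+ length l)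
  sum-const s []      k = sym (ℚ.*-zeroʳ s)
  sum-const s (A ∷ l) k = trans
    (cong₂ ℚ._+_ (sym (ℚ.*-identityʳ s)) (sum-const s l k)) (distrib s 1ℤ (+ length l))
  sum₁ : ∀ s l k → seq (sumᴿ (λ i → fromℚ s *ᴿ fromℤ (proj₁ (lookup l i)))) k ≡
    s ℚ.* toℚ (proj₁ (endpoint l))
  sum₁ s []      k = sym (ℚ.*-zeroʳ s)
  sum₁ s (A ∷ l) k = trans
    (cong (s ℚ.* toℚ (proj₁ A) ℚ.+_) (sum₁ s l k)) (distrib s (proj₁ A) (proj₁ (endpoint l)))
  sum₂ : ∀ s l k → seq (sumᴿ (λ i → fromℚ s *ᴿ fromℤ (proj₂ (lookup l i)))) k ≡
    s ℚ.* toℚ (proj₂ (endpoint l))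
  sum₂ s []      k = sym (ℚ.*-zeroʳ s)
  sum₂ s (A ∷ l) k = trans
    (cong (s ℚ.* toℚ (proj₂ A) ℚ.+_) (sum₂ s l k)) (distrib s (proj₂ A) (proj₂ (endpoint l)))

-- Half-planes bounded by a line through `O`

functional : OpenHalfPlane → ℤ² → ℝ
functional H (a , b) = α *ᴿ fromℤ a +ᴿ β *ᴿ fromℤ b
  where open OpenHalfPlane H

functional-+² : ∀ H A B n →
  seq (functional H (A +² B)) n ≡ seq (functional H A) n ℚ.+ seq (functional H B) n
functional-+² H (a , b) (a′ , b′) n = trans
  (cong₂ (λ r s → seq α n ℚ.* r ℚ.+ seq β n ℚ.* s) (toℚ-+ a a′) (toℚ-+ b b′))
  (identity (seq α n) (seq β n) (toℚ a) (toℚ b) (toℚ a′) (toℚ b′))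
  where
  open OpenHalfPlane H
  identity : ∀ p q a b a′ b′ → p ℚ.* (a ℚ.+ a′) ℚ.+ q ℚ.* (b ℚ.+ b′) ≡
    (p ℚ.* a ℚ.+ q ℚ.* b) ℚ.+ (p ℚ.* a′ ℚ.+ q ℚ.* b′)
  identity = solve 6 (λ p q a b a′ b′ → p :* (a :+ a′) :+ q :* (b :+ b′) :=
    (p :* a :+ q :* b) :+ (p :* a′ :+ q :* b′)) refl
    where open +-*-Solver

functional-O : ∀ H n → seq (functional H O) n ≡ 0ℚ
functional-O H n = cong₂ ℚ._+_ (ℚ.*-zeroʳ (seq α n)) (ℚ.*-zeroʳ (seq β n))
  where open OpenHalfPlane H

functional-*² : ∀ H k A n →
  seq (functional H ((+ k) *² A)) n ≡ toℚ (+ k) ℚ.* seq (functional H A) n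
functional-*² H k (a , b) n = trans
  (cong₂ (λ r s → seq α n ℚ.* r ℚ.+ seq β n ℚ.* s) (toℚ-* (+ k) a) (toℚ-* (+ k) b))
  (identity (seq α n) (seq β n) (toℚ (+ k)) (toℚ a) (toℚ b))
  where
  open OpenHalfPlane H
  identity : ∀ p q k a b → p ℚ.* (k ℚ.* a) ℚ.+ q ℚ.* (k ℚ.* b) ≡ k ℚ.* (p ℚ.* a ℚ.+ q ℚ.* b)
  identity = solve 5 (λ p q k a b → p :* (k :* a) :+ q :* (k :* b) := k :* (p :* a :+ q :* b)) refl
    where open +-*-Solver

-- With `O` on the boundary, `γ` equals 0 as a real, though its sequence may differ; comparing with
-- `0ᴿ` removes `γ` from the additive arguments.
Above : OpenHalfPlane → Pred ℤ² _
Above H A = 0ᴿ <ᴿ functional H A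

-- Half of the gap absorbs the error in `r ≤ᴿ s`, and the other half remains as the new gap. This is
-- what allows `γ` and `0ᴿ` to be exchanged.
≤ᴿ-<ᴿ-trans : ∀ {r s t} → r ≤ᴿ s → s <ᴿ t → r <ᴿ t
≤ᴿ-<ᴿ-trans {r} {s} {t} r≤s (ε , 0<ε , M , f) =
  let N , g = r≤s (ε ℚ.* ½) (half-pos 0<ε)
  in ε ℚ.* ½ , half-pos 0<ε , M ℕ.⊔ N , λ n ≤n → begin
    seq r n ℚ.+ ε ℚ.* ½
      ≤⟨ ℚ.+-monoˡ-≤ (ε ℚ.* ½) (g n (ℕ.m⊔n≤o⇒n≤o M N ≤n)) ⟩
    seq s n ℚ.+ ε ℚ.* ½ ℚ.+ ε ℚ.* ½
      ≡⟨ trans (ℚ.+-assoc (seq s n) (ε ℚ.* ½) (ε ℚ.* ½)) (cong (seq s n ℚ.+_) (half+half≡ ε)) ⟩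
    seq s n ℚ.+ ε
      ≤⟨ f n (ℕ.m⊔n≤o⇒m≤o M N ≤n) ⟩
    seq t n ∎
  where open ℚ.≤-Reasoning

module _ (H : OpenHalfPlane) (O∈∂H : ι O ∈ OpenHalfPlane.boundary H) where
  open OpenHalfPlane H

  private
    functional-O≈0 : functional H O ≈ᴿ 0ᴿ
    functional-O≈0 = pointwise-≡⇒≈ᴿ {functional H O} {0ᴿ} (functional-O H)

  interior⇒Above : ι A ∈ interior → A ∈ Above H
  interior⇒Above {A} = ≤ᴿ-<ᴿ-trans {0ᴿ} {γ} {functional H A}
    (≤ᴿ-trans {0ᴿ} {functional H O} {γ} (proj₂ functional-O≈0) (proj₁ O∈∂H))

  Above⇒interior : A ∈ Above H → ι A ∈ interior
  Above⇒interior {A} = ≤ᴿ-<ᴿ-trans {γ} {0ᴿ} {functional H A}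
    (≤ᴿ-trans {γ} {functional H O} {0ᴿ} (proj₂ O∈∂H) (proj₁ functional-O≈0))

O∉Above : ∀ H → O ∉ Above H
O∉Above H (ε , 0<ε , N , f) = ℚ.<-irrefl refl (begin-strict
  0ℚ                       <⟨ 0<ε ⟩
  ε                        ≡⟨ ℚ.+-identityˡ ε ⟨
  0ℚ ℚ.+ ε                 ≤⟨ f N ℕ.≤-refl ⟩
  seq (functional H O) N   ≡⟨ functional-O H N ⟩
  0ℚ                       ∎)
  where open ℚ.≤-Reasoning

Above-+² : ∀ H → A ∈ Above H → B ∈ Above H → A +² B ∈ Above H
Above-+² {A} {B} H (ε , 0<ε , M , f) (δ , 0<δ , N , g) =
  ε ℚ.+ δ , ℚ.+-mono-< 0<ε 0<δ , M ℕ.⊔ N , λ n ≤n → begin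
    0ℚ ℚ.+ (ε ℚ.+ δ)
      ≡⟨ cong₂ (λ p q → 0ℚ ℚ.+ (p ℚ.+ q)) (ℚ.+-identityˡ ε) (ℚ.+-identityˡ δ) ⟨
    0ℚ ℚ.+ ((0ℚ ℚ.+ ε) ℚ.+ (0ℚ ℚ.+ δ))
      ≡⟨ ℚ.+-identityˡ _ ⟩
    (0ℚ ℚ.+ ε) ℚ.+ (0ℚ ℚ.+ δ)
      ≤⟨ ℚ.+-mono-≤ (f n (ℕ.m⊔n≤o⇒m≤o M N ≤n)) (g n (ℕ.m⊔n≤o⇒n≤o M N ≤n)) ⟩
    seq (functional H A) n ℚ.+ seq (functional H B) n
      ≡⟨ functional-+² H A B n ⟨
    seq (functional H (A +² B)) n ∎
  where open ℚ.≤-Reasoning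

Loop⇒¬LC : Loop X → ¬ LC X
Loop⇒¬LC {X = X} (A , w , X[Aw] , eq) (H , O∈∂H , X⊆H) =
  O∉Above H (subst (_∈ Above H) eq (endpoint-Above X[Aw]))
  where
  X⇒Above : ∀ {A} → A ∈ X → A ∈ Above H
  X⇒Above {A} A∈X = interior⇒Above H O∈∂H {A} (X⊆H {A} A∈X)
  -- The induction starts at one letter, since the empty word ends at `O`, which is not `Above`.
  endpoint-Above : ∀ {A w} → All X (A ∷ w) → endpoint (A ∷ w) ∈ Above H
  endpoint-Above {A} (A∈X ∷ [])         = subst (_∈ Above H) (sym (+²-identityʳ A)) (X⇒Above A∈X)
  endpoint-Above {A} {B ∷ w} (A∈X ∷ X[Bw]) =
    Above-+² {A} {endpoint (B ∷ w)} H (X⇒Above A∈X) (endpoint-Above X[Bw])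

-- A Cauchy sequence is eventually above any of its late values minus one,
-- which provides the lower bound for the functional at P.
eventually-Above : ∀ H → A ∈ Above H → ∀ P →
  ∃[ k₀ ] (∀ k → k₀ ℕ.≤ k → (+ k) *² A +² P ∈ Above H)
eventually-Above {A} H (ε , 0<ε , M , f) P =
  let N , g = cauchy (functional H P) 1ℚ 0<1ℚ
      v = seq (functional H P) N
      -- Late values of the functional at `P` are at least `v - 1`, so `k₀ ε` must make up the
      -- difference between this and the desired gap `ε`.
      k₀ , bound = archimedean (1ℚ ℚ.+ ε ℚ.- v) ε 0<ε
  in k₀ , λ k k₀≤k → ε , 0<ε , M ℕ.⊔ N , λ n ≤n → begin
    0ℚ ℚ.+ ε
      ≡⟨ first ε v ⟩
    (1ℚ ℚ.+ ε ℚ.- v) ℚ.+ (v ℚ.- 1ℚ)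
      ≤⟨ ℚ.+-mono-≤ bound (v-1≤ (seq (functional H P) n) v (g N n ℕ.≤-refl (ℕ.m⊔n≤o⇒n≤o M N ≤n))) ⟩
    toℚ (+ k₀) ℚ.* ε ℚ.+ seq (functional H P) n
      ≤⟨ ℚ.+-monoˡ-≤ (seq (functional H P) n)
           (ℚ.*-monoʳ-≤-nonNeg ε {{ℚ.nonNegative (ℚ.<⇒≤ 0<ε)}} (toℚ-mono-≤ (ℤ.+≤+ k₀≤k))) ⟩
    toℚ (+ k) ℚ.* ε ℚ.+ seq (functional H P) n
      ≤⟨ ℚ.+-monoˡ-≤ (seq (functional H P) n)
           (ℚ.*-monoˡ-≤-nonNeg (toℚ (+ k)) {{ℚ.nonNegative (toℚ-mono-≤ {0ℤ} {+ k} (ℤ.+≤+ ℕ.z≤n))}}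
             (subst (ℚ._≤ seq (functional H A) n) (ℚ.+-identityˡ ε) (f n (ℕ.m⊔n≤o⇒m≤o M N ≤n)))) ⟩
    toℚ (+ k) ℚ.* seq (functional H A) n ℚ.+ seq (functional H P) n
      ≡⟨ cong (ℚ._+ seq (functional H P) n) (functional-*² H k A n) ⟨
    seq (functional H ((+ k) *² A)) n ℚ.+ seq (functional H P) n
      ≡⟨ functional-+² H ((+ k) *² A) P n ⟨
    seq (functional H ((+ k) *² A +² P)) n ∎
  where
  open ℚ.≤-Reasoning
  open +-*-Solver
  first : ∀ ε v → 0ℚ ℚ.+ ε ≡ (1ℚ ℚ.+ ε ℚ.- v) ℚ.+ (v ℚ.- 1ℚ)
  first = solve 2 (λ ε v → con 0ℚ :+ ε := (con 1ℚ :+ ε :- v) :+ (v :- con 1ℚ)) refl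
  second : ∀ u v → v ℚ.- 1ℚ ≡ (v ℚ.- u) ℚ.+ (u ℚ.- 1ℚ)
  second = solve 2 (λ u v → v :- con 1ℚ := (v :- u) :+ (u :- con 1ℚ)) refl
  third : ∀ u → 1ℚ ℚ.+ (u ℚ.- 1ℚ) ≡ u
  third = solve 1 (λ u → con 1ℚ :+ (u :- con 1ℚ) := u) refl
  v-1≤ : ∀ u v → ℚ.∣ v ℚ.- u ∣ ℚ.< 1ℚ → v ℚ.- 1ℚ ℚ.≤ u
  v-1≤ u v close = begin
    v ℚ.- 1ℚ                   ≡⟨ second u v ⟩
    (v ℚ.- u) ℚ.+ (u ℚ.- 1ℚ)   ≤⟨ ℚ.+-monoˡ-≤ (u ℚ.- 1ℚ) (ℚ.≤-trans (p≤∣p∣ (v ℚ.- u)) (ℚ.<⇒≤ close)) ⟩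
    1ℚ ℚ.+ (u ℚ.- 1ℚ)          ≡⟨ third u ⟩
    u                          ∎

-- Cone points and walks confined to `C`

Absorbing : Pred ℤ² c → Pred ℤ² c
Absorbing C A = ∀ P → ∃[ k₀ ] (∀ k → k₀ ℕ.≤ k → (+ k) *² A +² P ∈ C)

-- Large multiples of a point of the cone outweigh any fixed `P` in both half-planes at once. The
-- walk argument uses the cone only through this property.
cone-absorbing : ∀ K → ι O ∈ Cone.IsVertex K → (∀ {A} → ι A ∈ Cone.points K → A ∈ C) →
  ι A ∈ Cone.points K → Absorbing C A
cone-absorbing {A = A} K (O∈∂H₁ , O∈∂H₂) K⊆C (A∈H₁ , A∈H₂) P =
  let k₁ , f = eventually-Above {A} H₁ (interior⇒Above H₁ O∈∂H₁ {A} A∈H₁) P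
      k₂ , g = eventually-Above {A} H₂ (interior⇒Above H₂ O∈∂H₂ {A} A∈H₂) P
  in k₁ ℕ.⊔ k₂ , λ k ≤k → let Q = (+ k) *² A +² P in K⊆C {Q}
       ( Above⇒interior H₁ O∈∂H₁ {Q} (f k (ℕ.m⊔n≤o⇒m≤o k₁ k₂ ≤k))
       , Above⇒interior H₂ O∈∂H₂ {Q} (g k (ℕ.m⊔n≤o⇒n≤o k₁ k₂ ≤k)))
  where open Cone K

-- The prefix condition of `𝓕`, recast by recursion on the word with a movable starting point, so
-- that concatenation and translation go by induction.
Stays : Pred ℤ² c → ℤ² → Word → Set c
Stays C P []      = P ∈ C
Stays C P (A ∷ w) = P ∈ C × Stays C (P +² A) w

prefixes⇒Stays : ∀ w → (∀ m → m ℕ.≤ length w → P +² endpoint (take m w) ∈ C) → Stays C P w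
prefixes⇒Stays {P = P} {C = C} []      h = subst (_∈ C) (+²-identityʳ P) (h 0 ℕ.z≤n)
prefixes⇒Stays {P = P} {C = C} (A ∷ w) h =
  subst (_∈ C) (+²-identityʳ P) (h 0 ℕ.z≤n) ,
  prefixes⇒Stays w λ m m≤ → subst (_∈ C) (sym (+²-assoc P A (endpoint (take m w)))) (h (suc m) (ℕ.s≤s m≤))

Stays⇒start : ∀ w → Stays C P w → P ∈ C
Stays⇒start []      P∈C       = P∈C
Stays⇒start (A ∷ w) (P∈C , _) = P∈C

Stays⇒prefixes : ∀ w → Stays C P w → ∀ m → m ℕ.≤ length w → P +² endpoint (take m w) ∈ C
Stays⇒prefixes {C = C} {P = P} w       s       zero    _          =
  subst (_∈ C) (sym (+²-identityʳ P)) (Stays⇒start w s)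
Stays⇒prefixes {C = C} {P = P} (A ∷ w) (_ , s) (suc m) (ℕ.s≤s m≤) =
  subst (_∈ C) (+²-assoc P A (endpoint (take m w))) (Stays⇒prefixes w s m m≤)

Stays⇒end : ∀ w → Stays C P w → P +² endpoint w ∈ C
Stays⇒end {C = C} {P = P} []      s       = subst (_∈ C) (sym (+²-identityʳ P)) s
Stays⇒end {C = C} {P = P} (A ∷ w) (_ , s) = subst (_∈ C) (+²-assoc P A (endpoint w)) (Stays⇒end w s)

Stays-++ : ∀ u {w} → Stays C P u → Stays C (P +² endpoint u) w → Stays C P (u ++ w)
Stays-++ {C = C} {P = P} []      {w} _         t = subst (λ Q → Stays C Q w) (+²-identityʳ P) t
Stays-++ {C = C} {P = P} (A ∷ u) {w} (P∈C , s) t =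
  P∈C , Stays-++ u s (subst (λ Q → Stays C Q w) (sym (+²-assoc P A (endpoint u))) t)

-- Every visited point is translated by `Q`, and `C` is closed under addition. A walk allowed from
-- `O` is therefore allowed from any point of `C`.
Stays-shift : IsSubmonoid C → Q ∈ C → ∀ w → Stays C P w → Stays C (Q +² P) w
Stays-shift                 C-sub Q∈C []      P∈C       = IsSubmonoid.+-closed C-sub Q∈C P∈C
Stays-shift {C = C} {Q} {P} C-sub Q∈C (A ∷ w) (P∈C , s) = IsSubmonoid.+-closed C-sub Q∈C P∈C ,
  subst (λ R → Stays C R w) (sym (+²-assoc Q P A)) (Stays-shift C-sub Q∈C w s)

-- Repeated words

repeat : ℕ → Word → Word
repeat n w = concat (replicate n w)

endpoint-repeat : ∀ n w → endpoint (repeat n w) ≡ (+ n) *² endpoint w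
endpoint-repeat zero    w = refl
endpoint-repeat (suc n) w = trans (endpoint-++ w (repeat n w))
  (trans (cong (endpoint w +²_) (endpoint-repeat n w)) (sym (suc-*² n (endpoint w))))

-- Each copy is nonempty and so contributes at least one letter.
length-repeat-≥ : ∀ n A w → n ℕ.≤ length (repeat n (A ∷ w))
length-repeat-≥ zero    A w = ℕ.z≤n
length-repeat-≥ (suc n) A w = ℕ.s≤s (ℕ.≤-trans (length-repeat-≥ n A w) (length-++-≤ʳ (repeat n (A ∷ w)) {w}))

-- After the first copy, the others form a walk from `O` translated by `endpoint w`, which lies in
-- `C`.
Stays-repeat : IsSubmonoid C → ∀ n w → Stays C O w → Stays C O (repeat n w)
Stays-repeat         C-sub zero    w s = IsSubmonoid.O∈C C-sub
Stays-repeat {C = C} C-sub (suc n) w s = Stays-++ w s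
  (subst (λ Q → Stays C Q (repeat n w)) (+²-identityʳ (O +² endpoint w))
    (Stays-shift C-sub (Stays⇒end w s) (repeat n w) (Stays-repeat C-sub n w s)))

-- A closed walk returns to `P`, so every copy visits the same points as the first.
Stays-repeat-loop : ∀ n w → endpoint w ≡ O → Stays C P w → Stays C P (repeat n w)
Stays-repeat-loop                 zero    w eq s = Stays⇒start w s
Stays-repeat-loop {C = C} {P = P} (suc n) w eq s = Stays-++ w s
  (subst (λ Q → Stays C Q (repeat n w)) (sym (trans (cong (P +²_) eq) (+²-identityʳ P)))
    (Stays-repeat-loop n w eq s))

-- A walk visits finitely many points, each with its own threshold; take the maximum.
absorbing-Stays : Absorbing C A → ∀ w P → ∃[ k₀ ] (∀ k → k₀ ℕ.≤ k → Stays C ((+ k) *² A +² P) w)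
absorbing-Stays         absorbs []      P = absorbs P
absorbing-Stays {C = C} {A} absorbs (B ∷ w) P =
  let k₁ , f = absorbs P
      k₂ , g = absorbing-Stays absorbs w (P +² B)
  in k₁ ℕ.⊔ k₂ , λ k ≤k → f k (ℕ.m⊔n≤o⇒m≤o k₁ k₂ ≤k) ,
     subst (λ Q → Stays C Q w) (sym (+²-assoc ((+ k) *² A) P B)) (g k (ℕ.m⊔n≤o⇒n≤o k₁ k₂ ≤k))

Loop⇒¬FPP : IsSubmonoid C → A ∈ 𝓐 X C → Absorbing C A → Loop X → ¬ FPP X C
Loop⇒¬FPP {C = C} {X = X} C-sub (u , (u∈X , u⊆C) , refl) absorbs (B , w , X[Bw] , loop) fpp =
  -- All the words `walk n` share one endpoint, so finiteness is tested there, with `walk 0` showing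
  -- that it is reachable.
  let ws , complete = fpp (walk 0 , walk-𝓕 0 , walk-end 0)
      -- This exceeds the length of every listed word, whereas `walk n` has length at least `n`.
      n = suc (max 0 (map length ws))
      n≤ = All.lookup (xs≤max 0 (map length ws)) (∈-map⁺ length (complete (walk-𝓕 n , walk-end n)))
  in ℕ.<-irrefl refl (ℕ.≤-trans (length-repeat-≥ n B w)
       (ℕ.≤-trans (length-++-≤ʳ (repeat n (B ∷ w)) {repeat k u}) n≤))
  where
  -- Enough copies of `u` that the loop, started at their endpoint, stays in `C`.
  k = proj₁ (absorbing-Stays absorbs (B ∷ w) O)
  walk : ℕ → Word
  walk n = repeat k u ++ repeat n (B ∷ w)
  start≡ : O +² endpoint (repeat k u) ≡ (+ k) *² endpoint u +² O
  start≡ = trans (+²-identityˡ _) (trans (endpoint-repeat k u) (sym (+²-identityʳ _)))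
  walk-stays : ∀ n → Stays C O (walk n)
  walk-stays n = Stays-++ (repeat k u)
    (Stays-repeat C-sub k u (prefixes⇒Stays u λ m m≤ →
      subst (_∈ C) (sym (+²-identityˡ (endpoint (take m u)))) (u⊆C m m≤)))
    (subst (λ Q → Stays C Q (repeat n (B ∷ w))) (sym start≡)
      (Stays-repeat-loop n (B ∷ w) loop (proj₂ (absorbing-Stays absorbs (B ∷ w) O) k ℕ.≤-refl)))
  walk-𝓕 : ∀ n → walk n ∈ 𝓕 X C
  walk-𝓕 n =
    ++⁺ (concat⁺ (replicate⁺ k u∈X)) (concat⁺ (replicate⁺ n X[Bw])) ,
    λ m m≤ → subst (_∈ C) (+²-identityˡ (endpoint (take m (walk n))))
      (Stays⇒prefixes (walk n) (walk-stays n) m m≤)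
  walk-end : ∀ n → endpoint (walk n) ≡ endpoint (repeat k u)
  walk-end n = trans (endpoint-++ (repeat k u) (repeat n (B ∷ w)))
    (trans (cong (endpoint (repeat k u) +²_)
      (trans (endpoint-repeat n (B ∷ w))
        (trans (cong ((+ n) *²_) loop) (cong₂ _,_ (ℤ.*-zeroʳ (+ n)) (ℤ.*-zeroʳ (+ n))))))
      (+²-identityʳ (endpoint (repeat k u))))

theorem3p18 : ∀ {x c : Level} (X : Pred ℤ² x) → O ∉ X → Finite X →
    (C : Pred ℤ² c) → IsSubmonoid C →
    ∃[ K ] ( ι O ∈ Cone.IsVertex K
    × (∀ {A : ℤ²} → ι A ∈ Cone.points K → A ∈ C)
    × ∃[ A ] (ι A ∈ Cone.points K × A ∈ 𝓐 X C)) →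
    (FPP X C ⇔ (ι O ∉ Conv X)) × ((ι O ∉ Conv X) ⇔ LC X)
theorem3p18 X _ X-finite@(bs , X⇔bs) C C-sub (K , O-vertex , K⊆C , A , A∈K , A∈𝓐)
  with gordan bs
... | inj₁ (F , F≢O , 0<F) =
    -- All three conditions hold here, so each implication returns its conclusion outright.
    mk⇔ {A = FPP X C} (λ _ → O∉Conv) (λ _ {A} → positive⇒FPP {C = C} X-finite F positive {A})
  , mk⇔ (λ _ → positive⇒LC F F≢O positive) (λ _ → O∉Conv)
  where
  positive : Positive F X
  positive A∈X = All.lookup 0<F (Equivalence.to (X⇔bs _) A∈X)
  O∉Conv = positive⇒O∉Conv F positive
... | inj₂ loop-bs =
    -- All three conditions fail here, so each implication is vacuous.
    mk⇔ {A = FPP X C} (λ fpp → ⊥-elim (¬FPP fpp)) (λ O∉Conv → ⊥-elim (O∉Conv O∈Conv))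
  , mk⇔ (contradiction O∈Conv) (⊥-elim ∘ Loop⇒¬LC loop)
  where
  loop : Loop X
  loop = Loop-⊆ (Equivalence.from (X⇔bs _)) loop-bs
  O∈Conv = Loop⇒O∈Conv loop
  ¬FPP : ¬ FPP X C
  ¬FPP = Loop⇒¬FPP C-sub A∈𝓐 (cone-absorbing {A = A} K O-vertex (λ {B} → K⊆C {B}) A∈K) loop
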